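{- Let $n\ge 1$, let $\mu$ be a partition of length $\ell(\mu)\leq n$ and let $\delta=(n,n-1,\ldots,1)$, so that $\lambda=\mu+\delta$ (i.e. $\lambda_i=\mu_i+n-i+1$ for $1\le i\le n$) is a strict partition of length $\ell(\lambda)=n$. Let $\mathbf{x}=(x_1,\ldots,x_n)$, $\mathbf{y}=(y_1,\ldots,y_n)$ and $\mathbf{a}=(a_1,a_2,\ldots)$ be sequences of independent parameters. Then $$P_\lambda(\mathbf{x};\mathbf{y}|\mathbf{a}) = \prod_{1\leq i \leq n} x_i \ \prod_{1\leq i<j \leq n} (x_i + y_j)\ s_{\mu} (\mathbf{x}|\mathbf{a})$$ and $$Q_\lambda(\mathbf{x};\mathbf{y}|\mathbf{a}) = \prod_{1\leq i\leq j \leq n} (x_i + y_j)\ s_{\mu} (\mathbf{x}|\mathbf{a}).$$ Equivalently, $$\sum_{P\in\mathcal{P}^\lambda} \mathrm{wgt}(P) = \prod_{1\leq i \leq n} x_i \prod_{1\leq i<j \leq n} (x_i + y_j) \sum_{T\in\mathcal{T}^\mu} \mathrm{wgt}(T)$$ and $$\sum_{Q\in\mathcal{Q}^\lambda} \mathrm{wgt}(Q) = \prod_{1\leq i\leq j \leq n} (x_i + y_j) \sum_{T\in\mathcal{T}^\mu} \mathrm{wgt}(T).$$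
   Context: A partition is a weakly decreasing sequence of non-negative integers; its length $\ell(\lambda)$ is the number of non-zero parts; a partition is strict if its parts $\lambda_1>\lambda_2>\cdots>\lambda_n$ are distinct. Diagrams (matrix coordinates: $i$ is the row, numbered from top to bottom, $j$ the column, from left to right): $F^\mu=\{(i,j): 1\le i\le \ell(\mu),\ 1\le j\le \mu_i\}$. For strict $\lambda$, the shifted diagram is $SF^\lambda=\{(i,j): 1\le i\le\ell(\lambda),\ i\le j\le i+\lambda_i-1\}$. The main diagonal consists of the boxes $(i,i)$. Semistandard tableaux: $\mathcal{T}^\mu$ is the set of all fillings $T=(t_{ij})$ of $F^\mu$ with entries in $\{1<2<\cdots<n\}$ that weakly increase from left to right along rows and strictly increase from top to bottom down columns. Primed shifted tableaux: $\mathcal{Q}^\lambda$ is the set of all fillings of $SF^\lambda$ with entries from the ordered alphabet $1'<1<2'<2<\cdots<n'<n$ such that entries weakly increase from left to right along rows, entries weakly increase from top to bottom down columns, for each $k$ at most one entry $k'$ appears in any row, and for each $k$ at most one (unprimed) entry $k$ appears in any column. $\mathcal{P}^\lambda\subseteq\mathcal{Q}^\lambda$ is the subset of those fillings with no primed entries on the main diagonal. Weights: the weight of a tableau is the product of the weights of its entries over all boxes. - For $T\in\mathcal{T}^\mu$: an entry $t_{ij}=k$ has weight $x_k+a_{k+j-i}$. - For $P\in\mathcal{P}^\lambda$: a diagonal entry $p_{ii}=k$ has weight $x_k$; for $i<j$, $p_{ij}=k$ has weight $x_k+a_{j-i}$ and $p_{ij}=k'$ has weight $y_k-a_{j-i}$.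 - For $Q\in\mathcal{Q}^\lambda$: a diagonal entry $q_{ii}=k$ has weight $x_k$ and $q_{ii}=k'$ has weight $y_k$; for $i<j$, $q_{ij}=k$ has weight $x_k+a_{j-i}$ and $q_{ij}=k'$ has weight $y_k-a_{j-i}$. The factorial Schur function is $s_\mu(\mathbf{x}|\mathbf{a})=\sum_{T\in\mathcal{T}^\mu}\mathrm{wgt}(T)$, and the factorial generalised Schur $P$- and $Q$-functions are $P_\lambda(\mathbf{x};\mathbf{y}|\mathbf{a})=\sum_{P\in\mathcal{P}^\lambda}\mathrm{wgt}(P)$ and $Q_\lambda(\mathbf{x};\mathbf{y}|\mathbf{a})=\sum_{Q\in\mathcal{Q}^\lambda}\mathrm{wgt}(Q)$. -}

module Defs where

open import Algebra.Bundles using (CommutativeRing)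
open import Data.Bool.Base using (if_then_else_)
open import Data.Fin.Base using (Fin; zero; suc; toℕ; _≤_; _<_)
open import Data.Fin.Properties using (all?; _≟_; _≤?_; _<?_)
open import Data.List.Base using (List; []; _∷_; [_]; allFin; cartesianProductWith; filter; foldr; map; _++_)
open import Data.Nat.Base as ℕ using (ℕ; zero; suc; _∸_)
import Data.Nat.Properties as ℕₚ
open import Data.Product.Base using (_×_)
open import Data.Vec.Base as Vec using (Vec; []; _∷_; lookup)
open import Data.Vec.Relation.Unary.All using (All; []; _∷_)
open import Data.Vec.Relation.Unary.All.Properties using (lookup⁺)
open import Data.Vec.Relation.Unary.Linked using (Linked; []; [-]; _∷_)
open import Relation.Binary.Definitions using (DecidableEquality)
open import Relation.Binary.PropositionalEquality.Core using (_≡_; _≢_; refl; cong)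
open import Relation.Nullary.Decidable using (Dec; no; does; map′; ¬?; _×-dec_; _→-dec_)

private
  variable
    A : Set
    m n : ℕ

-- A partition of length at most n, padded with zeros to exactly n parts.

IsPartition : Vec ℕ n → Set
IsPartition = Linked ℕ._≥_

δ : ∀ n → Vec ℕ n
δ zero    = []
δ (suc n) = suc n ∷ δ n

infixl 6 _⊕_

_⊕_ : Vec ℕ n → Vec ℕ n → Vec ℕ n
_⊕_ = Vec.zipWith ℕ._+_

⊕δ-strict : {μ : Vec ℕ n} → IsPartition μ → Linked ℕ._>_ (μ ⊕ δ n)
⊕δ-strict {μ = []}        []      = []
⊕δ-strict {μ = _ ∷ []}    [-]     = [-]
⊕δ-strict {μ = _ ∷ _ ∷ _} (p ∷ q) = ℕₚ.+-mono-≤-< p (ℕₚ.n<1+n _) ∷ ⊕δ-strict q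

⊕δ-positive : (μ : Vec ℕ n) → All (0 ℕ.<_) (μ ⊕ δ n)
⊕δ-positive {zero}  []      = []
⊕δ-positive {suc n} (p ∷ μ) = ℕₚ.m≤n⇒m≤o+n p (ℕ.s≤s ℕ.z≤n) ∷ ⊕δ-positive μ

-- Fillings of a diagram with row lengths ν, stored row by row.  `entry t i j`
-- is the j-th entry of row i, both counted from 0.  Its column (also counted
-- from 0) is j in the unshifted diagram and i + j in the shifted one, so
-- that in the shifted diagram j is the distance from the main diagonal.

Filling : Set → Vec ℕ m → Set
Filling A = All (Vec A)

entry : {ν : Vec ℕ m} → Filling A ν → (i : Fin m) → Fin (lookup ν i) → A
entry t i j = lookup (lookup⁺ t i) j

-- All words of a given length, and all fillings of a given shape, over an
-- alphabet listed without repetition; each occurs exactly once.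

words : List A → ∀ k → List (Vec A k)
words as zero    = [ [] ]
words as (suc k) = cartesianProductWith _∷_ as (words as k)

fillings : List A → (ν : Vec ℕ m) → List (Filling A ν)
fillings as []      = [ [] ]
fillings as (k ∷ ν) = cartesianProductWith _∷_ (words as k) (fillings as ν)

-- The letter k of the alphabet 1, …, n is the element k - 1 of Fin n.

module _ {ν : Vec ℕ m} (t : Filling (Fin n) ν) where

  RowsWeaklyIncrease : Set
  RowsWeaklyIncrease = ∀ i j j′ → j ≤ j′ → entry t i j ≤ entry t i j′

  ColumnsStrictlyIncrease : Set
  ColumnsStrictlyIncrease =
    ∀ i i′ j j′ → i < i′ → toℕ j ≡ toℕ j′ → entry t i j < entry t i′ j′

  IsSemistandard : Set
  IsSemistandard = RowsWeaklyIncrease × ColumnsStrictlyIncrease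

  isSemistandard? : Dec IsSemistandard
  isSemistandard? =
    (all? λ i → all? λ j → all? λ j′ →
      (j ≤? j′) →-dec (entry t i j ≤? entry t i j′))
    ×-dec
    (all? λ i → all? λ i′ → all? λ j → all? λ j′ →
      (i <? i′) →-dec ((toℕ j ℕₚ.≟ toℕ j′) →-dec (entry t i j <? entry t i′ j′)))

𝒯 : ∀ n (μ : Vec ℕ m) → List (Filling (Fin n) μ)
𝒯 n μ = filter isSemistandard? (fillings (allFin n) μ)

data Letter (n : ℕ) : Set where
  primed unprimed : Fin n → Letter n

letters : ∀ n → List (Letter n)
letters n = map primed (allFin n) ++ map unprimed (allFin n)

-- The position in the alphabet 1′ < 1 < 2′ < 2 < ⋯ < n′ < n.

rank : Letter n → ℕ
rank (primed k)   = 2 ℕ.* toℕ k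
rank (unprimed k) = suc (2 ℕ.* toℕ k)

infix 4 _≼_ _≼?_ _≟ᴸ_

_≼_ : Letter n → Letter n → Set
k ≼ l = rank k ℕ.≤ rank l

_≼?_ : (k l : Letter n) → Dec (k ≼ l)
k ≼? l = rank k ℕₚ.≤? rank l

_≟ᴸ_ : DecidableEquality (Letter n)
primed k   ≟ᴸ primed l   = map′ (cong primed) (λ { refl → refl }) (k ≟ l)
primed k   ≟ᴸ unprimed l = no λ ()
unprimed k ≟ᴸ primed l   = no λ ()
unprimed k ≟ᴸ unprimed l = map′ (cong unprimed) (λ { refl → refl }) (k ≟ l)

module _ {ν : Vec ℕ m} (t : Filling (Letter n) ν) where

  SameColumn : (i i′ : Fin m) → Fin (lookup ν i) → Fin (lookup ν i′) → Set
  SameColumn i i′ j j′ = toℕ i ℕ.+ toℕ j ≡ toℕ i′ ℕ.+ toℕ j′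

  ShiftedRowsWeaklyIncrease : Set
  ShiftedRowsWeaklyIncrease = ∀ i j j′ → j ≤ j′ → entry t i j ≼ entry t i j′

  ShiftedColumnsWeaklyIncrease : Set
  ShiftedColumnsWeaklyIncrease =
    ∀ i i′ j j′ → i ≤ i′ → SameColumn i i′ j j′ → entry t i j ≼ entry t i′ j′

  AtMostOnePrimedPerRow : Set
  AtMostOnePrimedPerRow =
    ∀ k i j j′ → entry t i j ≡ primed k → entry t i j′ ≡ primed k → j ≡ j′

  AtMostOneUnprimedPerColumn : Set
  AtMostOneUnprimedPerColumn =
    ∀ k i i′ j j′ → SameColumn i i′ j j′ →
    entry t i j ≡ unprimed k → entry t i′ j′ ≡ unprimed k → i ≡ i′

  IsPrimedShifted : Set
  IsPrimedShifted =
    ShiftedRowsWeaklyIncrease × ShiftedColumnsWeaklyIncrease ×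
    AtMostOnePrimedPerRow × AtMostOneUnprimedPerColumn

  UnprimedDiagonal : Set
  UnprimedDiagonal = ∀ k i j → toℕ j ≡ 0 → entry t i j ≢ primed k

  sameColumn? : ∀ i i′ j j′ → Dec (SameColumn i i′ j j′)
  sameColumn? i i′ j j′ = toℕ i ℕ.+ toℕ j ℕₚ.≟ toℕ i′ ℕ.+ toℕ j′

  isPrimedShifted? : Dec IsPrimedShifted
  isPrimedShifted? =
    (all? λ i → all? λ j → all? λ j′ →
      (j ≤? j′) →-dec (entry t i j ≼? entry t i j′))
    ×-dec
    (all? λ i → all? λ i′ → all? λ j → all? λ j′ →
      (i ≤? i′) →-dec (sameColumn? i i′ j j′ →-dec (entry t i j ≼? entry t i′ j′)))
    ×-dec
    (all? λ k → all? λ i → all? λ j → all? λ j′ →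
      (entry t i j ≟ᴸ primed k) →-dec ((entry t i j′ ≟ᴸ primed k) →-dec (j ≟ j′)))
    ×-dec
    (all? λ k → all? λ i → all? λ i′ → all? λ j → all? λ j′ →
      sameColumn? i i′ j j′ →-dec
      ((entry t i j ≟ᴸ unprimed k) →-dec ((entry t i′ j′ ≟ᴸ unprimed k) →-dec (i ≟ i′))))

  unprimedDiagonal? : Dec UnprimedDiagonal
  unprimedDiagonal? =
    all? λ k → all? λ i → all? λ j →
      (toℕ j ℕₚ.≟ 0) →-dec ¬? (entry t i j ≟ᴸ primed k)

-- The row lengths ν are meant to form a strict partition, as those of μ ⊕ δ n
-- do by ⊕δ-strict and ⊕δ-positive.

𝒬 : ∀ n (ν : Vec ℕ m) → List (Filling (Letter n) ν)
𝒬 n ν = filter isPrimedShifted? (fillings (letters n) ν)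

𝒫 : ∀ n (ν : Vec ℕ m) → List (Filling (Letter n) ν)
𝒫 n ν = filter unprimedDiagonal? (𝒬 n ν)

module FactorialSchur {c ℓ} (R : CommutativeRing c ℓ) where

  open CommutativeRing R
  open import Algebra.Properties.CommutativeMonoid.Sum *-commutativeMonoid public
    using () renaming (sum to ∏)

  ∑ : List A → (A → Carrier) → Carrier
  ∑ ts f = foldr (λ t s → f t + s) 0# ts

  ∏-< : (Fin n → Fin n → Carrier) → Carrier
  ∏-< f = ∏ λ i → ∏ λ j → if does (i <? j) then f i j else 1#

  ∏-≤ : (Fin n → Fin n → Carrier) → Carrier
  ∏-≤ f = ∏ λ i → ∏ λ j → if does (i ≤? j) then f i j else 1#

  ∏-boxes : {ν : Vec ℕ m} → Filling A ν →
            ((i : Fin m) → Fin (lookup ν i) → A → Carrier) → Carrier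
  ∏-boxes t w = ∏ λ i → ∏ λ j → w i j (entry t i j)

  -- The parameters a₁, a₂, … are a 1, a 2, …; the value a 0 is never used.

  -- With 1-based coordinates the index is k + j - i.  In a semistandard
  -- tableau k ≥ i, so the subtraction is never truncated.

  wgtᵀ : (x : Fin n → Carrier) (a : ℕ → Carrier) {μ : Vec ℕ m} →
         Filling (Fin n) μ → Carrier
  wgtᵀ x a t = ∏-boxes t λ i j k →
    x k + a (suc (toℕ k) ℕ.+ suc (toℕ j) ∸ suc (toℕ i))

  letterWgt : (x y : Fin n → Carrier) (a : ℕ → Carrier) →
              ℕ → Letter n → Carrier
  letterWgt x y a zero        (unprimed k) = x k
  letterWgt x y a zero        (primed k)   = y k
  letterWgt x y a d@(suc _)   (unprimed k) = x k + a d
  letterWgt x y a d@(suc _)   (primed k)   = y k - a d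

  -- Serves for both 𝒫 and 𝒬: the two weights differ only in that a primed
  -- diagonal entry does not arise in 𝒫.

  wgt : (x y : Fin n → Carrier) (a : ℕ → Carrier) {ν : Vec ℕ m} →
        Filling (Letter n) ν → Carrier
  wgt x y a t = ∏-boxes t λ i j → letterWgt x y a (toℕ j)

  schur : Vec ℕ m → (x : Fin n → Carrier) (a : ℕ → Carrier) → Carrier
  schur {n = n} μ x a = ∑ (𝒯 n μ) (wgtᵀ x a)

  schurP : Vec ℕ m → (x y : Fin n → Carrier) (a : ℕ → Carrier) → Carrier
  schurP {n = n} ν x y a = ∑ (𝒫 n ν) (wgt x y a)

  schurQ : Vec ℕ m → (x y : Fin n → Carrier) (a : ℕ → Carrier) → Carrier
  schurQ {n = n} ν x y a = ∑ (𝒬 n ν) (wgt x y a)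

{-# OPTIONS --safe #-}
module Submission where

-- Write λ = μ + δ and encode a tableau by removing its largest letter n.  In
-- terms of λ this turns both sides into sums over strict partitions κ with n - 1
-- parts.  On the Schur side the removal is an operator H with
--
--   (H g)(λ) = Σ_κ ∏_i ∏_{κᵢ < d < λᵢ} (xₙ + a_d) g(κ)   over λᵢ₊₁ ≤ κᵢ < λᵢ.
--
-- On the shifted side, removing first the letters n and then the letters n′ gives
-- (xₙ + zₙ) H V, where zₙ is the weight of n′ on the main diagonal and V is the
-- tensor power of the one-row operator g ↦ (k ↦ g(k + 1) + (yₙ - a_k) g(k)).
-- Now V H = (x + y) H V, so V multiplies the factorial Schur function of
-- x₁, …, xₙ₋₁ by ∏_{i < n} (xᵢ + yₙ), and induction on n finishes the proof.
-- The choice z = y gives Q and z = 0 gives P.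

open import Defs
open import Algebra.Bundles using (CommutativeRing)
open import Data.Bool.Base using (Bool; true; false; _∧_; _∨_; not; T; if_then_else_)
open import Data.Bool.Properties using (∧-zeroʳ; T-∨; T-∧)
open import Data.Empty using (⊥-elim)
open import Data.Fin.Base as Fin using (Fin; zero; suc; toℕ)
import Data.Fin.Properties as Finₚ
open import Data.List.Base using (List; []; _∷_; _++_; map; filter; downFrom; allFin; tabulate; cartesianProductWith)
open import Data.Nat.Base as ℕ using (ℕ; zero; suc; _∸_; _<ᵇ_; _≤ᵇ_; _≡ᵇ_)
import Data.Nat.Properties as ℕₚ
open import Data.Product.Base using (_×_; _,_; proj₁; proj₂; Σ-syntax)
open import Data.Sum.Base using (_⊎_; inj₁; inj₂)
open import Data.Unit.Base using (⊤; tt)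
open import Data.Vec.Base as Vec using (Vec; []; _∷_; _∷ʳ_; lookup)
open import Data.Vec.Properties using (lookup-map)
open import Data.Vec.Relation.Unary.All as All using (All; []; _∷_)
open import Data.Vec.Relation.Unary.Linked as Linked using (Linked; []; [-]; _∷_)
open import Function.Base using (_∘_; const; id)
open import Function.Bundles using (module Equivalence)
import Level
open import Relation.Binary.Definitions using (tri<; tri≈; tri>)
open import Relation.Binary.PropositionalEquality.Core as ≡ using (_≡_; _≢_)
open import Relation.Nullary.Decidable using (Dec; does; dec-true; dec-false)
open import Relation.Nullary.Negation using (¬_)

open Equivalence using (to; from)

-- Adding δ straightens the index of a. With as many rows as letters, the index k + j - i carried by
-- the letter being removed turns into the 0-based position d of the box in its row of λ, which is
-- the distance from the main diagonal on the shifted side. The same equality of rows and letters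
-- forces each removal to empty the last row, so a variable and a row disappear together; on the
-- shifted side the diagonal box of that row holds n or n′, whence the factor xₙ + zₙ. The obstacle
-- is that `V` leaves the strict partitions: raising a part may make it equal to the one above. The
-- relation between `V` and `H` is therefore proved for functions that vanish whenever two adjacent
-- parts agree. Factorial Schur functions do, because no part can interlace with two equal ones. The
-- parameters a disappear from the factor through (x + a_d) + (y - a_d) = x + y. One removal
-- argument serves both kinds of tableaux: all that matters about a letter is whether it may repeat
-- along rows or down columns.

private
  variable
    A A′ L : Set
    k l m n p q : ℕ
    ν : Vec ℕ n

<ᵇ-false : k ℕ.≤ l → (l <ᵇ k) ≡ false
<ᵇ-false ℕ.z≤n       = ≡.refl
<ᵇ-false (ℕ.s≤s k≤l) = <ᵇ-false k≤l

-- Finite sums, linear functionals and interval products.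

module Sums {c ℓ} (R : CommutativeRing c ℓ) where

  open CommutativeRing R hiding (zero)
  open FactorialSchur R
  open import Algebra.Properties.Ring ring using (-1*x≈-x)
  open import Algebra.Properties.Group +-group using (∙-cancelʳ)
  open import Algebra.Solver.Ring.NaturalCoefficients.Default commutativeSemiring
    using (solve; _:=_; _:+_; _:*_)
  open import Relation.Binary.Reasoning.Setoid setoid

  -- Iverson bracket: tableau conditions become factors, so that sums over tableaux become sums over
  -- all words.
  ⟦_⟧ : Bool → Carrier
  ⟦ true ⟧  = 1#
  ⟦ false ⟧ = 0#

  ⟦∧⟧ : ∀ b b′ → ⟦ b ∧ b′ ⟧ ≈ ⟦ b ⟧ * ⟦ b′ ⟧
  ⟦∧⟧ true  b′ = sym (*-identityˡ _)
  ⟦∧⟧ false b′ = sym (zeroˡ _)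

  ⟦⟧-cong : ∀ b {u v} → (T b → u ≈ v) → ⟦ b ⟧ * u ≈ ⟦ b ⟧ * v
  ⟦⟧-cong true  eq = *-congˡ (eq _)
  ⟦⟧-cong false eq = trans (zeroˡ _) (sym (zeroˡ _))

  ⟦T⟧ : ∀ b {u} → T b → ⟦ b ⟧ * u ≈ u
  ⟦T⟧ true _ = *-identityˡ _

  ∑-cong : ∀ (as : List A) {f g : A → Carrier} → (∀ a → f a ≈ g a) → ∑ as f ≈ ∑ as g
  ∑-cong []       eq = refl
  ∑-cong (a ∷ as) eq = +-cong (eq a) (∑-cong as eq)

  ∑<-cong : ∀ k {f g : ℕ → Carrier} → (∀ r → r ℕ.< k → f r ≈ g r) →
            ∑ (downFrom k) f ≈ ∑ (downFrom k) g
  ∑<-cong zero    eq = refl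
  ∑<-cong (suc k) eq =
    +-cong (eq k ℕₚ.≤-refl) (∑<-cong k λ r r<k → eq r (ℕₚ.m<n⇒m<1+n r<k))

  ∑-0 : ∀ (as : List A) → ∑ as (const 0#) ≈ 0#
  ∑-0 []       = refl
  ∑-0 (a ∷ as) = trans (+-identityˡ _) (∑-0 as)

  ∑-++ : ∀ (as : List A) {bs f} → ∑ (as ++ bs) f ≈ ∑ as f + ∑ bs f
  ∑-++ []       = sym (+-identityˡ _)
  ∑-++ (a ∷ as) = trans (+-congˡ (∑-++ as)) (sym (+-assoc _ _ _))

  ∑-map : ∀ (h : A → L) as {f} → ∑ (map h as) f ≈ ∑ as (f ∘ h)
  ∑-map h []       = refl
  ∑-map h (a ∷ as) = +-congˡ (∑-map h as)

  ∑-cartesian : ∀ (h : A → A′ → L) as {bs f} →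
                ∑ (cartesianProductWith h as bs) f ≈ ∑ as (λ a → ∑ bs (f ∘ h a))
  ∑-cartesian h []       = refl
  ∑-cartesian h (a ∷ as) {bs} =
    trans (∑-++ (map (h a) bs)) (+-cong (∑-map (h a) bs) (∑-cartesian h as))

  ∑-filter : ∀ {P : A → Set} (P? : ∀ a → Dec (P a)) as {f} →
             ∑ (filter P? as) f ≈ ∑ as (λ a → ⟦ does (P? a) ⟧ * f a)
  ∑-filter P? []       = refl
  ∑-filter P? (a ∷ as) with does (P? a)
  ... | true  = +-cong (sym (*-identityˡ _)) (∑-filter P? as)
  ... | false = trans (∑-filter P? as) (sym (trans (+-congʳ (zeroˡ _)) (+-identityˡ _)))

  ∑<-suc : ∀ k (f : ℕ → Carrier) →
           ∑ (downFrom (suc k)) f ≈ f 0 + ∑ (downFrom k) (f ∘ suc)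
  ∑<-suc zero    f = refl
  ∑<-suc (suc k) f = begin
    f (suc k) + ∑ (downFrom (suc k)) f               ≈⟨ +-congˡ (∑<-suc k f) ⟩
    f (suc k) + (f 0 + ∑ (downFrom k) (f ∘ suc))     ≈⟨ solve 3 (λ a b c → a :+ (b :+ c) := b :+ (a :+ c)) refl _ _ _ ⟩
    f 0 + (f (suc k) + ∑ (downFrom k) (f ∘ suc))     ∎

  -- Every operator below is a finite linear combination of evaluations. Linearity is what lets `V`
  -- and the removal operators pass through sums; `cong` belongs to it because functions are
  -- compared pointwise in a setoid.
  record Linear (F : (A → Carrier) → Carrier) : Set (c Level.⊔ ℓ) where
    field
      cong : ∀ {g g′} → (∀ a → g a ≈ g′ a) → F g ≈ F g′
      comb : ∀ g k g′ → F (λ a → g a + k * g′ a) ≈ F g + k * F g′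

    scale : ∀ k (g : A → Carrier) → F (λ a → k * g a) ≈ k * F g
    zeros : F (const 0#) ≈ 0#
    zeros = begin
      -- The law `comb` with factor -1 and both functions zero gives F 0 = F 0 - F 0.
      F (const 0#)                          ≈⟨ cong (λ _ → sym (trans (+-congˡ (zeroʳ _)) (+-identityˡ _))) ⟩
      F (λ _ → 0# + - 1# * 0#)              ≈⟨ comb _ _ _ ⟩
      F (const 0#) + - 1# * F (const 0#)    ≈⟨ +-congˡ (-1*x≈-x _) ⟩
      F (const 0#) + - F (const 0#)         ≈⟨ -‿inverseʳ _ ⟩
      0#                                    ∎
    scale k g = begin
      F (λ a → k * g a)                     ≈⟨ cong (λ _ → sym (+-identityˡ _)) ⟩
      F (λ a → 0# + k * g a)                ≈⟨ comb _ _ _ ⟩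
      F (const 0#) + k * F g                ≈⟨ +-congʳ zeros ⟩
      0# + k * F g                          ≈⟨ +-identityˡ _ ⟩
      k * F g                               ∎

    sums : ∀ (as : List L) (k : L → Carrier) (g : L → A → Carrier) →
            F (λ a → ∑ as (λ b → k b * g b a)) ≈ ∑ as (λ b → k b * F (g b))
    sums []       k g = zeros
    sums (b ∷ as) k g = begin
      F (λ a → k b * g b a + ∑ as (λ b → k b * g b a))     ≈⟨ cong (λ _ → +-comm _ _) ⟩
      F (λ a → ∑ as (λ b → k b * g b a) + k b * g b a)     ≈⟨ comb _ _ _ ⟩
      F (λ a → ∑ as (λ b → k b * g b a)) + k b * F (g b)   ≈⟨ +-congʳ (sums as k g) ⟩
      ∑ as (λ b → k b * F (g b)) + k b * F (g b)           ≈⟨ +-comm _ _ ⟩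
      k b * F (g b) + ∑ as (λ b → k b * F (g b))           ∎

  open Linear

  eval-linear : (a : A) → Linear (λ g → g a)
  eval-linear a .cong eq     = eq a
  eval-linear a .comb g k g′ = refl

  ∘-linear : ∀ {F : (A → Carrier) → Carrier} (h : A → L) → Linear F → Linear (λ g → F (g ∘ h))
  ∘-linear h lin .cong eq     = lin .cong (eq ∘ h)
  ∘-linear h lin .comb g k g′ = lin .comb (g ∘ h) k (g′ ∘ h)

  *-linear : ∀ {F : (A → Carrier) → Carrier} x → Linear F → Linear (λ g → x * F g)
  *-linear x lin .cong eq     = *-congˡ (lin .cong eq)
  *-linear x lin .comb g k g′ = trans (*-congˡ (lin .comb g k g′))
    (solve 4 (λ x u k v → x :* (u :+ k :* v) := x :* u :+ k :* (x :* v)) refl x _ k _)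

  +-linear : ∀ {F G : (A → Carrier) → Carrier} → Linear F → Linear G → Linear (λ g → F g + G g)
  +-linear lin lin′ .cong eq     = +-cong (lin .cong eq) (lin′ .cong eq)
  +-linear lin lin′ .comb g k g′ = trans (+-cong (lin .comb g k g′) (lin′ .comb g k g′))
    (solve 5 (λ u k v s t → (u :+ k :* v) :+ (s :+ k :* t) := (u :+ s) :+ k :* (v :+ t)) refl _ k _ _ _)

  ∑-linear : ∀ {F : L → (A → Carrier) → Carrier} bs → (∀ b → Linear (F b)) →
             Linear (λ g → ∑ bs (λ b → F b g))
  ∑-linear []       lin .cong eq     = refl
  ∑-linear []       lin .comb g k g′ = sym (trans (+-identityˡ _) (zeroʳ k))
  ∑-linear (b ∷ bs) lin = +-linear (lin b) (∑-linear bs lin)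

  sum-linear : ∀ (as : List A) → Linear (∑ as)
  sum-linear as = ∑-linear as eval-linear

  -- Product over q ≤ j < l, with value 1 when l ≤ q. The index j stays absolute, since the
  -- parameters a are indexed by it.
  ∏[_,_⟩ : ℕ → ℕ → (ℕ → Carrier) → Carrier
  ∏[ q     , zero  ⟩ f = 1#
  ∏[ zero  , suc l ⟩ f = f 0 * ∏[ 0 , l ⟩ (f ∘ suc)
  ∏[ suc q , suc l ⟩ f = ∏[ q , l ⟩ (f ∘ suc)

  interval-cong : ∀ q l {f g} → (∀ j → f j ≈ g j) → ∏[ q , l ⟩ f ≈ ∏[ q , l ⟩ g
  interval-cong q       zero    eq = refl
  interval-cong zero    (suc l) eq = *-cong (eq 0) (interval-cong 0 l (eq ∘ suc))
  interval-cong (suc q) (suc l) eq = interval-cong q l (eq ∘ suc)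

  interval-last : ∀ {q l} f → q ℕ.≤ l → ∏[ q , suc l ⟩ f ≈ ∏[ q , l ⟩ f * f l
  interval-last {l = zero}  f ℕ.z≤n       = *-comm _ _
  interval-last {l = suc l} f ℕ.z≤n       =
    trans (*-congˡ (interval-last (f ∘ suc) ℕ.z≤n)) (sym (*-assoc _ _ _))
  interval-last             f (ℕ.s≤s q≤l) = interval-last (f ∘ suc) q≤l

  interval-first : ∀ {q l} f → q ℕ.< l → ∏[ q , l ⟩ f ≈ f q * ∏[ suc q , l ⟩ f
  interval-first {zero}  f (ℕ.s≤s ℕ.z≤n) = refl
  interval-first {suc q} f (ℕ.s≤s q<l)   = interval-first (f ∘ suc) q<l

  interval-empty : ∀ l f → ∏[ l , l ⟩ f ≈ 1#
  interval-empty zero    f = refl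
  interval-empty (suc l) f = interval-empty l (f ∘ suc)

  -- The operators `H` and `V` and their commutation relation.

  module Operators (a : ℕ → Carrier) where

    -- The last row is left with part 0, which is dropped from κ; hence the product over 0 < d < k
    -- there.
    H : Carrier → Vec ℕ (suc m) → (Vec ℕ m → Carrier) → Carrier
    H x (k ∷ [])     g = ∏[ 1 , k ⟩ (λ d → x + a d) * g []
    H x (k ∷ l ∷ ks) g = ∑ (downFrom k) λ r →
      ⟦ l <ᵇ suc r ⟧ * (∏[ suc r , k ⟩ (λ d → x + a d) * H x (l ∷ ks) (g ∘ (r ∷_)))

    -- The two summands stand for a row without and with the single primed letter that it may
    -- contain.
    V : Carrier → Vec ℕ m → (Vec ℕ m → Carrier) → Carrier
    V y []       g = g []
    V y (k ∷ ks) g = V y ks (g ∘ (suc k ∷_)) + (y - a k) * V y ks (g ∘ (k ∷_))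

    -- The factorial Schur function of μ as a sum over Gelfand–Tsetlin patterns,
    -- with the index shifted to μ + δ.

    Z : (ℕ → Carrier) → Vec ℕ m → Carrier
    Z {zero}  x ks = 1#
    Z {suc m} x ks = H (x m) ks (Z x)

    H-linear : ∀ x (ks : Vec ℕ (suc m)) → Linear (H x ks)
    H-linear x (k ∷ [])     = *-linear _ (eval-linear [])
    H-linear x (k ∷ l ∷ ks) = ∑-linear (downFrom k) λ r →
      *-linear _ (*-linear _ (∘-linear (r ∷_) (H-linear x (l ∷ ks))))

    V-linear : ∀ y (ks : Vec ℕ m) → Linear (V y ks)
    V-linear y []       = eval-linear []
    V-linear y (k ∷ ks) = +-linear (∘-linear (suc k ∷_) (V-linear y ks))
                                   (*-linear _ (∘-linear (k ∷_) (V-linear y ks)))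

    -- The degenerate vectors that `V` can produce from a strict partition.
    data Repeat : Vec ℕ n → Set where
      here  : ∀ {k} {ks : Vec ℕ n} → Repeat (k ∷ k ∷ ks)
      there : ∀ {k} {ks : Vec ℕ n} → Repeat ks → Repeat (k ∷ ks)

    -- Between equal parts the range k ≤ r < k of the interlacing part is empty.
    H-repeat : ∀ x {ks : Vec ℕ (suc m)} → Repeat ks → ∀ g → H x ks g ≈ 0#
    H-repeat x (here {k = k}) g =
      trans (∑<-cong k λ r r<k → trans (*-congʳ (reflexive (≡.cong ⟦_⟧ (<ᵇ-false r<k)))) (zeroˡ _))
            (∑-0 (downFrom k))
    H-repeat x {k ∷ l ∷ ks} (there rep) g =
      trans (∑-cong (downFrom k) λ r → trans (*-congˡ (trans (*-congˡ (H-repeat x rep _)) (zeroʳ _))) (zeroʳ _))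
            (∑-0 (downFrom k))

    Z-repeat : ∀ x {ks : Vec ℕ m} → Repeat ks → Z x ks ≈ 0#
    Z-repeat {suc m} x rep = H-repeat _ rep _

    StrictPositive : Vec ℕ m → Set
    StrictPositive []           = ⊤
    StrictPositive (k ∷ [])     = 0 ℕ.< k
    StrictPositive (k ∷ l ∷ ks) = l ℕ.< k × StrictPositive (l ∷ ks)

    head-positive : ∀ {k} (ks : Vec ℕ m) → StrictPositive (k ∷ ks) → 0 ℕ.< k
    head-positive []       0<k         = 0<k
    head-positive (l ∷ ks) (l<k , pos) = ℕₚ.≤-<-trans ℕ.z≤n l<k

    data Interlace : Vec ℕ (suc m) → Vec ℕ m → Set where
      [_] : ∀ k → Interlace (k ∷ []) []
      _∷_ : ∀ {k l r} {ks : Vec ℕ m} {rs} → (l ℕ.≤ r × r ℕ.< k) →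
            Interlace (l ∷ ks) rs → Interlace (k ∷ l ∷ ks) (r ∷ rs)

    -- A part of λ separates any two neighbours of κ: it lies weakly below the first and strictly
    -- above the second. This returns the induction to strict partitions after each `H`.
    interlace-strict : ∀ {ks : Vec ℕ (suc m)} {rs} → All (0 ℕ.<_) ks → Interlace ks rs → StrictPositive rs
    interlace-strict pos             [ k ]               = tt
    interlace-strict (_ ∷ 0<l ∷ pos) ((l≤r , _) ∷ [ l ]) = ℕₚ.≤-trans 0<l l≤r
    interlace-strict (_ ∷ pos)       ((l≤r , _) ∷ rest@((_ , r′<l) ∷ _)) =
      ℕₚ.<-≤-trans r′<l l≤r , interlace-strict pos rest

    -- Equality is asked only on the shapes that `H` sums over, so that hypotheses about strict or
    -- positive κ can be applied under `H`.
    H-cong : ∀ x (ks : Vec ℕ (suc m)) {g g′} → (∀ rs → Interlace ks rs → g rs ≈ g′ rs) →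
             H x ks g ≈ H x ks g′
    H-cong x (k ∷ [])     eq = *-congˡ (eq [] [ k ])
    H-cong x (k ∷ l ∷ ks) eq = ∑<-cong k λ r r<k → ⟦⟧-cong (l <ᵇ suc r) λ l≤r →
      *-congˡ (H-cong x (l ∷ ks) λ rs il → eq (r ∷ rs) ((ℕₚ.≤-pred (ℕₚ.<ᵇ⇒< l (suc r) l≤r) , r<k) ∷ il))

    -- Positivity, unlike strictness, survives the step from k to k or k + 1.
    V-cong : ∀ y (ks : Vec ℕ m) {g g′} → All (0 ℕ.<_) ks →
             (∀ rs → All (0 ℕ.<_) rs → g rs ≈ g′ rs) → V y ks g ≈ V y ks g′
    V-cong y []       []        eq = eq [] []
    V-cong y (k ∷ ks) (p ∷ pos) eq = +-cong
      (V-cong y ks pos λ rs pos′ → eq _ (ℕₚ.0<1+n ∷ pos′))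
      (*-congˡ (V-cong y ks pos λ rs pos′ → eq _ (p ∷ pos′)))

    strict⇒positive : ∀ {ks : Vec ℕ m} → StrictPositive ks → All (0 ℕ.<_) ks
    strict⇒positive {ks = []}         _             = []
    strict⇒positive {ks = k ∷ []}     0<k           = 0<k ∷ []
    strict⇒positive {ks = k ∷ l ∷ ks} pos@(_ , pos′) = head-positive (l ∷ ks) pos ∷ strict⇒positive pos′

    module _ (x y : Carrier) where

      private
        X : ℕ → ℕ → Carrier
        X r k = ∏[ r , k ⟩ (λ d → x + a d)

      -- The unprimed and the primed weight at the same distance from the diagonal add up to
      -- something free of a.
      slide : ∀ d → (x + a d) + (y - a d) ≈ x + y
      slide d = begin
        (x + a d) + (y - a d)   ≈⟨ solve 4 (λ x a y b → (x :+ a) :+ (y :+ b) := (x :+ y) :+ (a :+ b)) refl x (a d) y (- a d) ⟩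
        (x + y) + (a d - a d)   ≈⟨ +-congˡ (-‿inverseʳ _) ⟩
        (x + y) + 0#            ≈⟨ +-identityʳ _ ⟩
        x + y                   ∎

      merge : ∀ d u → (x + a d) * u + (y - a d) * u ≈ (x + y) * u
      merge d u = trans (sym (distribʳ _ _ _)) (*-congʳ (slide d))

      -- One row of `H`, with everything that happens in the lower rows collected in `F`.
      D : ℕ → ℕ → (ℕ → Carrier) → Carrier
      D l k F = ∑ (downFrom k) λ r → ⟦ l <ᵇ suc r ⟧ * (X (suc r) k * F r)

      D-linear : ∀ l k → Linear (D l k)
      D-linear l k = ∑-linear (downFrom k) λ r → *-linear _ (*-linear _ (eval-linear r))

      -- Each old summand gains the factor at d = k, and r = k is the one new summand, with an empty
      -- product.
      D-suc : ∀ l k F → D l (suc k) F ≈ (x + a k) * D l k F + ⟦ l <ᵇ suc k ⟧ * F k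
      D-suc l k F = begin
        ⟦ l <ᵇ suc k ⟧ * (X (suc k) (suc k) * F k) + ∑ (downFrom k) (λ r → ⟦ l <ᵇ suc r ⟧ * (X (suc r) (suc k) * F r))
          ≈⟨ +-cong (*-congˡ (trans (*-congʳ (interval-empty (suc k) (λ d → x + a d))) (*-identityˡ _)))
                    (∑<-cong k λ r r<k → trans (*-congˡ (*-congʳ (interval-last (λ d → x + a d) r<k)))
                      (solve 4 (λ b p q h → b :* ((p :* q) :* h) := q :* (b :* (p :* h))) refl _ _ (x + a k) _)) ⟩
        ⟦ l <ᵇ suc k ⟧ * F k + ∑ (downFrom k) (λ r → (x + a k) * (⟦ l <ᵇ suc r ⟧ * (X (suc r) k * F r)))
          ≈⟨ +-congˡ (scale (sum-linear (downFrom k)) _ _) ⟩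
        ⟦ l <ᵇ suc k ⟧ * F k + (x + a k) * D l k F
          ≈⟨ +-comm _ _ ⟩
        (x + a k) * D l k F + ⟦ l <ᵇ suc k ⟧ * F k ∎

      ∑-split : ∀ {l k} (G : ℕ → Carrier) → l ℕ.< k →
                ∑ (downFrom k) (λ r → ⟦ l <ᵇ r ⟧ * G r) + G l ≈ ∑ (downFrom k) (λ r → ⟦ l <ᵇ suc r ⟧ * G r)
      ∑-split {zero}  {suc k} G _ = begin
        ∑ (downFrom (suc k)) (λ r → ⟦ 0 <ᵇ r ⟧ * G r) + G 0
          ≈⟨ +-congʳ (trans (∑<-suc k _) (trans (+-congʳ (zeroˡ _)) (+-identityˡ _))) ⟩
        ∑ (downFrom k) (λ r → 1# * G (suc r)) + G 0
          ≈⟨ trans (+-comm _ _) (+-congʳ (sym (*-identityˡ _))) ⟩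
        1# * G 0 + ∑ (downFrom k) (λ r → 1# * G (suc r))
          ≈⟨ sym (∑<-suc k _) ⟩
        ∑ (downFrom (suc k)) (λ r → 1# * G r)   ∎
      ∑-split {suc l} {suc k} G (ℕ.s≤s l<k) = begin
        ∑ (downFrom (suc k)) (λ r → ⟦ suc l <ᵇ r ⟧ * G r) + G (suc l)
          ≈⟨ +-congʳ (trans (∑<-suc k _) (trans (+-congʳ (zeroˡ _)) (+-identityˡ _))) ⟩
        ∑ (downFrom k) (λ r → ⟦ l <ᵇ r ⟧ * G (suc r)) + G (suc l)
          ≈⟨ ∑-split (G ∘ suc) l<k ⟩
        ∑ (downFrom k) (λ r → ⟦ l <ᵇ suc r ⟧ * G (suc r))
          ≈⟨ sym (trans (∑<-suc k _) (trans (+-congʳ (zeroˡ _)) (+-identityˡ _))) ⟩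
        ∑ (downFrom (suc k)) (λ r → ⟦ suc l <ᵇ suc r ⟧ * G r)   ∎

      D-empty : ∀ {l k} F → k ℕ.≤ l → D l k F ≈ 0#
      D-empty {l} {k} F k≤l =
        trans (∑<-cong k λ r r<k → trans (*-congʳ (reflexive (≡.cong ⟦_⟧ (<ᵇ-false (ℕₚ.≤-trans r<k k≤l))))) (zeroˡ _))
              (∑-0 (downFrom k))

      -- For l ≤ r < k, `F r` receives X r k from the preceding shifted summand, or from the
      -- boundary term if r = l, together with (y - a r) X (r + 1) k. These merge to (x + y) X (r +
      -- 1) k, and the last shifted summand leaves `F k`.
      telescope : ∀ {l k} (F : ℕ → Carrier) → l ℕ.≤′ k →
                  D l k (λ r → F (suc r) + (y - a r) * F r) + X l k * F l ≈ (x + y) * D l k F + F k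
      telescope {l} F ℕ.≤′-refl = begin
        D l l _ + X l l * F l        ≈⟨ +-cong (D-empty {l} {l} _ ℕₚ.≤-refl) (trans (*-congʳ (interval-empty l (λ d → x + a d))) (*-identityˡ _)) ⟩
        0# + F l                     ≈⟨ +-congʳ (sym (trans (*-congˡ (D-empty {l} {l} _ ℕₚ.≤-refl)) (zeroʳ _))) ⟩
        (x + y) * D l l F + F l      ∎
      telescope {l} {suc k} F (ℕ.≤′-step l≤′k) = begin
        D l (suc k) G + X l (suc k) * F l
          ≈⟨ +-cong (trans (D-suc l k G) (+-congˡ (⟦T⟧ (l <ᵇ suc k) l≤ᵇk))) (*-congʳ (interval-last (λ d → x + a d) l≤k)) ⟩
        ((x + a k) * D l k G + (F (suc k) + b * F k)) + (X l k * (x + a k)) * F l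
          ≈⟨ solve 7 (λ s d f b g t h → (s :* d :+ (f :+ b :* g)) :+ (t :* s) :* h := s :* (d :+ t :* h) :+ (f :+ b :* g)) refl (x + a k) _ _ b _ _ _ ⟩
        (x + a k) * (D l k G + X l k * F l) + (F (suc k) + b * F k)
          ≈⟨ +-congʳ (*-congˡ (telescope F l≤′k)) ⟩
        (x + a k) * ((x + y) * D l k F + F k) + (F (suc k) + b * F k)
          ≈⟨ solve 6 (λ s c d g f b → s :* (c :* d :+ g) :+ (f :+ b :* g) := c :* (s :* d) :+ (s :* g :+ b :* g) :+ f) refl (x + a k) (x + y) _ _ _ b ⟩
        (x + y) * ((x + a k) * D l k F) + ((x + a k) * F k + b * F k) + F (suc k)
          ≈⟨ +-congʳ (trans (+-congˡ (merge k (F k))) (sym (distribˡ _ _ _))) ⟩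
        (x + y) * ((x + a k) * D l k F + F k) + F (suc k)
          ≈⟨ +-congʳ (*-congˡ (sym (trans (D-suc l k F) (+-congˡ (⟦T⟧ (l <ᵇ suc k) l≤ᵇk))))) ⟩
        (x + y) * D l (suc k) F + F (suc k) ∎
        where
        b = y - a k
        G : ℕ → Carrier
        G r = F (suc r) + (y - a r) * F r
        l≤k = ℕₚ.≤′⇒≤ l≤′k
        l≤ᵇk = ℕₚ.<⇒<ᵇ (ℕ.s≤s l≤k)

      -- Raising the top part gives every old summand the factor x + a k. The new summand r = k
      -- evaluates `g` at a vector beginning with k, k, where it vanishes.
      H-suc-repeat : ∀ {k} → 0 ℕ.< k → ∀ (ks : Vec ℕ m) g → (∀ {rs} → Repeat rs → g rs ≈ 0#) →
                     H x (suc k ∷ ks) (g ∘ (k ∷_)) ≈ (x + a k) * H x (k ∷ ks) (g ∘ (k ∷_))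
      H-suc-repeat {k = k} 0<k [] g g-repeat =
        trans (*-congʳ (interval-last (λ d → x + a d) 0<k))
              (solve 3 (λ p q h → (p :* q) :* h := q :* (p :* h)) refl _ (x + a k) _)
      H-suc-repeat {k = k} 0<k (l ∷ ks) g g-repeat = begin
        H x (suc k ∷ l ∷ ks) (g ∘ (k ∷_))
          ≈⟨ D-suc l k _ ⟩
        (x + a k) * H x (k ∷ l ∷ ks) (g ∘ (k ∷_)) + ⟦ l <ᵇ suc k ⟧ * H x (l ∷ ks) (λ rs → g (k ∷ k ∷ rs))
          ≈⟨ +-congˡ (trans (*-congˡ (trans (H-linear x (l ∷ ks) .cong λ rs → g-repeat here) (zeros (H-linear x (l ∷ ks))))) (zeroʳ _)) ⟩
        (x + a k) * H x (k ∷ l ∷ ks) (g ∘ (k ∷_)) + 0#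
          ≈⟨ +-identityʳ _ ⟩
        (x + a k) * H x (k ∷ l ∷ ks) (g ∘ (k ∷_)) ∎

      V-D : ∀ (ks : Vec ℕ m) l k F → V y ks (λ κ → D l k (λ r → F r κ)) ≈ D l k (λ r → V y ks (F r))
      V-D ks l k F = begin
        V y ks (λ κ → D l k (λ r → F r κ))
          ≈⟨ V-linear y ks .cong (λ κ → ∑-cong (downFrom k) λ r → sym (*-assoc _ _ _)) ⟩
        V y ks (λ κ → ∑ (downFrom k) (λ r → (⟦ l <ᵇ suc r ⟧ * X (suc r) k) * F r κ))
          ≈⟨ sums (V-linear y ks) (downFrom k) (λ r → ⟦ l <ᵇ suc r ⟧ * X (suc r) k) F ⟩
        ∑ (downFrom k) (λ r → (⟦ l <ᵇ suc r ⟧ * X (suc r) k) * V y ks (F r))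
          ≈⟨ ∑-cong (downFrom k) (λ r → *-assoc _ _ _) ⟩
        D l k (λ r → V y ks (F r)) ∎

      -- Moving the top part k by V leaves a boundary term in row l on either side;
      -- both are evaluated by the induction hypothesis, using that g vanishes when
      -- two adjacent parts agree.  The common term is added to both sides and
      -- cancelled, which avoids subtraction.

      V-H : ∀ {ks : Vec ℕ (suc m)} → StrictPositive ks → ∀ g → (∀ {rs} → Repeat rs → g rs ≈ 0#) →
            V y ks (λ κ → H x κ g) ≈ (x + y) * H x ks (λ κ → V y κ g)
      V-H {ks = k ∷ []} 0<k g g-repeat = begin
        X 1 (suc k) * g [] + (y - a k) * (X 1 k * g [])
          ≈⟨ +-congʳ (trans (*-congʳ (interval-last (λ d → x + a d) 0<k)) (solve 3 (λ h⁺ h⁻ h → (h⁺ :* h⁻) :* h := h⁻ :* (h⁺ :* h)) refl _ (x + a k) _)) ⟩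
        (x + a k) * (X 1 k * g []) + (y - a k) * (X 1 k * g [])
          ≈⟨ merge k _ ⟩
        (x + y) * (X 1 k * g []) ∎
      V-H {ks = k ∷ l ∷ ks} (l<k , pos) g g-repeat = ∙-cancelʳ (c′ * (X (suc l) k * h⁺ l)) _ _ (begin
        V y (k ∷ l ∷ ks) (λ κ → H x κ g) + c′ * (X (suc l) k * h⁺ l)
          ≈⟨ +-congʳ expand ⟩
        c′ * (D (suc l) k h⁺ + bₗ * D l k h⁻ + e k) + c′ * (X (suc l) k * h⁺ l)
          ≈⟨ solve 5 (λ c s t u v → c :* (s :+ t :+ u) :+ c :* v := c :* ((s :+ v) :+ t :+ u)) refl c′ _ _ _ _ ⟩
        c′ * ((D (suc l) k h⁺ + X (suc l) k * h⁺ l) + bₗ * D l k h⁻ + e k)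
          -- The added term is the summand r = l that `D (suc l) k` lacks next to `D l k`. Only now
          -- do `h⁺` and `h⁻` run over the same range, so that `IH` applies under a single sum.
          ≈⟨ *-congˡ (+-congʳ (+-congʳ (∑-split _ l<k))) ⟩
        c′ * (D l k h⁺ + bₗ * D l k h⁻ + e k)
          ≈⟨ *-congˡ (+-congʳ (trans (sym (D-linear l k .comb h⁺ bₗ h⁻)) (trans (D-linear l k .cong IH) (scale (D-linear l k) c′ e)))) ⟩
        c′ * (c′ * D l k e + e k)
          ≈⟨ *-congˡ (sym (telescope e (ℕₚ.≤⇒≤′ (ℕₚ.<⇒≤ l<k)))) ⟩
        c′ * (D l k (λ r → e (suc r) + (y - a r) * e r) + X l k * e l)
          ≈⟨ distribˡ _ _ _ ⟩
        c′ * D l k (λ r → e (suc r) + (y - a r) * e r) + c′ * (X l k * e l)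
          ≈⟨ +-cong (*-congˡ (D-linear l k .cong λ r → sym (H-linear x (l ∷ ks) .comb _ _ _))) boundary ⟩
        c′ * H x (k ∷ l ∷ ks) (λ κ → V y κ g) + c′ * (X (suc l) k * h⁺ l) ∎)
        where
        c′ = x + y
        bₗ = y - a l
        bₖ = y - a k
        h⁺ h⁻ e : ℕ → Carrier
        h⁺ r = V y ks (λ κ → H x (suc l ∷ κ) (g ∘ (r ∷_)))
        h⁻ r = V y ks (λ κ → H x (l ∷ κ) (g ∘ (r ∷_)))
        e r = H x (l ∷ ks) (λ κ → V y κ (g ∘ (r ∷_)))

        IH : ∀ r → h⁺ r + bₗ * h⁻ r ≈ c′ * e r
        IH r = V-H {ks = l ∷ ks} pos (g ∘ (r ∷_)) (g-repeat ∘ there)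

        -- The induction hypothesis gives access to `e l` only through `c′ * e l`, so the factor
        -- `c′` is carried along. The factor x + a l split off from `X l k` then turns `h⁻ l` back
        -- into `h⁺ l`.
        boundary : c′ * (X l k * e l) ≈ c′ * (X (suc l) k * h⁺ l)
        boundary = begin
          c′ * (X l k * e l)                            ≈⟨ solve 3 (λ c h⁺ e → c :* (h⁺ :* e) := h⁺ :* (c :* e)) refl c′ _ _ ⟩
          X l k * (c′ * e l)                            ≈⟨ *-cong (interval-first (λ d → x + a d) l<k) (trans (sym (IH l)) (+-congʳ h⁺≈h⁻)) ⟩
          ((x + a l) * X (suc l) k) * ((x + a l) * h⁻ l + bₗ * h⁻ l)   ≈⟨ *-congˡ (merge l (h⁻ l)) ⟩
          ((x + a l) * X (suc l) k) * (c′ * h⁻ l)        ≈⟨ solve 4 (λ s h⁺ c h⁻ → (s :* h⁺) :* (c :* h⁻) := c :* (h⁺ :* (s :* h⁻))) refl (x + a l) _ c′ _ ⟩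
          c′ * (X (suc l) k * ((x + a l) * h⁻ l))        ≈⟨ *-congˡ (*-congˡ (sym h⁺≈h⁻)) ⟩
          c′ * (X (suc l) k * h⁺ l)                      ∎
          where
          h⁺≈h⁻ : h⁺ l ≈ (x + a l) * h⁻ l
          h⁺≈h⁻ = trans (V-linear y ks .cong λ κ → H-suc-repeat (head-positive ks pos) κ g g-repeat)
                      (scale (V-linear y ks) (x + a l) _)

        -- Effect of `V` on the top part over a fixed second part l′. It is needed for both values,
        -- l and l + 1, that `V` gives to the second part.
        row : ∀ l′ → l′ ℕ.≤ k → V y ks (λ κ → H x (suc k ∷ l′ ∷ κ) g) + bₖ * V y ks (λ κ → H x (k ∷ l′ ∷ κ) g)
              ≈ c′ * D l′ k (λ r → V y ks (λ κ → H x (l′ ∷ κ) (g ∘ (r ∷_)))) + V y ks (λ κ → H x (l′ ∷ κ) (g ∘ (k ∷_)))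
        row l′ l′≤k = begin
          V y ks (λ κ → H x (suc k ∷ l′ ∷ κ) g) + bₖ * V y ks (λ κ → H x (k ∷ l′ ∷ κ) g)
            ≈⟨ +-congʳ (V-linear y ks .cong λ κ → trans (D-suc l′ k _) (trans (+-congˡ (⟦T⟧ (l′ <ᵇ suc k) (ℕₚ.<⇒<ᵇ (ℕ.s≤s l′≤k)))) (+-comm _ _))) ⟩
          V y ks (λ κ → H x (l′ ∷ κ) (g ∘ (k ∷_)) + (x + a k) * H x (k ∷ l′ ∷ κ) g) + bₖ * V y ks (λ κ → H x (k ∷ l′ ∷ κ) g)
            ≈⟨ +-congʳ (V-linear y ks .comb _ _ _) ⟩
          V y ks (λ κ → H x (l′ ∷ κ) (g ∘ (k ∷_))) + (x + a k) * V y ks (λ κ → H x (k ∷ l′ ∷ κ) g) + bₖ * V y ks (λ κ → H x (k ∷ l′ ∷ κ) g)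
            ≈⟨ trans (+-assoc _ _ _) (trans (+-comm _ _) (+-congʳ (merge k _))) ⟩
          c′ * V y ks (λ κ → H x (k ∷ l′ ∷ κ) g) + V y ks (λ κ → H x (l′ ∷ κ) (g ∘ (k ∷_)))
            ≈⟨ +-congʳ (*-congˡ (V-D ks l′ k _)) ⟩
          c′ * D l′ k (λ r → V y ks (λ κ → H x (l′ ∷ κ) (g ∘ (r ∷_)))) + V y ks (λ κ → H x (l′ ∷ κ) (g ∘ (k ∷_))) ∎

        expand : V y (k ∷ l ∷ ks) (λ κ → H x κ g) ≈ c′ * (D (suc l) k h⁺ + bₗ * D l k h⁻ + e k)
        expand = begin
          (V y ks (λ κ → H x (suc k ∷ suc l ∷ κ) g) + bₗ * V y ks (λ κ → H x (suc k ∷ l ∷ κ) g))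
          + bₖ * (V y ks (λ κ → H x (k ∷ suc l ∷ κ) g) + bₗ * V y ks (λ κ → H x (k ∷ l ∷ κ) g))
            ≈⟨ solve 6 (λ s b t c u v → (s :+ b :* t) :+ c :* (u :+ b :* v) := (s :+ c :* u) :+ b :* (t :+ c :* v)) refl _ bₗ _ bₖ _ _ ⟩
          (V y ks (λ κ → H x (suc k ∷ suc l ∷ κ) g) + bₖ * V y ks (λ κ → H x (k ∷ suc l ∷ κ) g))
          + bₗ * (V y ks (λ κ → H x (suc k ∷ l ∷ κ) g) + bₖ * V y ks (λ κ → H x (k ∷ l ∷ κ) g))
            ≈⟨ +-cong (row (suc l) l<k) (*-congˡ (row l (ℕₚ.<⇒≤ l<k))) ⟩
          (c′ * D (suc l) k h⁺ + h⁺ k) + bₗ * (c′ * D l k h⁻ + h⁻ k)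
            ≈⟨ solve 6 (λ c s h⁺ b t h⁻ → (c :* s :+ h⁺) :+ b :* (c :* t :+ h⁻) := c :* (s :+ b :* t) :+ (h⁺ :+ b :* h⁻)) refl c′ _ _ bₗ _ _ ⟩
          c′ * (D (suc l) k h⁺ + bₗ * D l k h⁻) + (h⁺ k + bₗ * h⁻ k)
            ≈⟨ +-congˡ (IH k) ⟩
          c′ * (D (suc l) k h⁺ + bₗ * D l k h⁻) + c′ * e k
            ≈⟨ sym (distribˡ _ _ _) ⟩
          c′ * (D (suc l) k h⁺ + bₗ * D l k h⁻ + e k) ∎

    V-Z : ∀ y x {ks : Vec ℕ m} → StrictPositive ks → V y ks (Z x) ≈ ∏[ 0 , m ⟩ (λ i → x i + y) * Z x ks
    V-Z y x {[]} pos = sym (*-identityˡ _)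
    V-Z {suc m} y x {ks} pos = begin
      V y ks (λ κ → Z x κ)
        ≈⟨ V-H (x m) y pos (Z x) (Z-repeat x) ⟩
      (x m + y) * H (x m) ks (λ κ → V y κ (Z x))
        ≈⟨ *-congˡ (H-cong (x m) ks λ κ il → V-Z y x (interlace-strict (strict⇒positive pos) il)) ⟩
      (x m + y) * H (x m) ks (λ κ → ∏[ 0 , m ⟩ (λ i → x i + y) * Z x κ)
        ≈⟨ *-congˡ (scale (H-linear (x m) ks) _ _) ⟩
      (x m + y) * (∏[ 0 , m ⟩ (λ i → x i + y) * H (x m) ks (Z x))
        ≈⟨ solve 3 (λ s t u → s :* (t :* u) := (t :* s) :* u) refl (x m + y) _ _ ⟩
      (∏[ 0 , m ⟩ (λ i → x i + y) * (x m + y)) * H (x m) ks (Z x)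
        ≈⟨ *-congʳ (sym (interval-last (λ i → x i + y) ℕ.z≤n)) ⟩
      ∏[ 0 , suc m ⟩ (λ i → x i + y) * H (x m) ks (Z x) ∎

-- Row and column conditions under removal of the largest letter.

-- Letters are encoded by their position in the alphabet.  A letter a with h a may
-- be repeated along rows (a semistandard or an unprimed entry), any other one down
-- columns (a primed entry); `before (not ∘ h)` is the relation down columns.

before : (ℕ → Bool) → ℕ → ℕ → Bool
before h a b = (a <ᵇ b) ∨ ((a ≡ᵇ b) ∧ h a)

<ᵇ-true : ∀ {a b} → a ℕ.< b → (a <ᵇ b) ≡ true
<ᵇ-true (ℕ.s≤s ℕ.z≤n)       = ≡.refl
<ᵇ-true (ℕ.s≤s (ℕ.s≤s a<b)) = <ᵇ-true (ℕ.s≤s a<b)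

≡ᵇ-refl : ∀ a → (a ≡ᵇ a) ≡ true
≡ᵇ-refl zero    = ≡.refl
≡ᵇ-refl (suc a) = ≡ᵇ-refl a

>⇒≡ᵇ-false : ∀ {a b} → b ℕ.< a → (a ≡ᵇ b) ≡ false
>⇒≡ᵇ-false (ℕ.s≤s ℕ.z≤n)       = ≡.refl
>⇒≡ᵇ-false (ℕ.s≤s (ℕ.s≤s b<a)) = >⇒≡ᵇ-false (ℕ.s≤s b<a)

before-< : ∀ h {a b} → a ℕ.< b → before h a b ≡ true
before-< h a<b rewrite <ᵇ-true a<b = ≡.refl

before-> : ∀ h {a b} → b ℕ.< a → before h a b ≡ false
before-> h b<a rewrite <ᵇ-false (ℕₚ.<⇒≤ b<a) | >⇒≡ᵇ-false b<a = ≡.refl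

before-≡ : ∀ h a → before h a a ≡ h a
before-≡ h a rewrite <ᵇ-false (ℕₚ.≤-refl {a}) | ≡ᵇ-refl a = ≡.refl

-- The copies of the largest letter m form the end of a row; padding by them undoes their removal.
pad : ℕ → ∀ l → Vec ℕ q → Vec ℕ l
pad m zero    v       = []
pad m (suc l) []      = m ∷ pad m l []
pad m (suc l) (a ∷ v) = a ∷ pad m l v

-- The flag s distinguishes shifted (true) from unshifted (false) diagrams.  A row
-- of length l fits below a row of length p if l ≤ p or, when shifted, l < p; the
-- empty row always fits, since intermediate shifted shapes may end in zeros.

lt : Bool → ℕ → ℕ → Bool
lt false l       p = l <ᵇ suc p
lt true  zero    p = true
lt true  (suc l) p = suc l <ᵇ p

-- With t = 1 this says that row i is nonempty, which is how shapes with too many rows for the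
-- alphabet are recognised.
data Part (t : ℕ) : ℕ → Vec ℕ n → Set where
  here  : ∀ {ν : Vec ℕ n} → t ℕ.≤ k → Part t 0 (k ∷ ν)
  there : ∀ {i} {ν : Vec ℕ n} → Part t i ν → Part t (suc i) (k ∷ ν)

module Shape (h : ℕ → Bool) where

  headOK : ℕ → Vec ℕ l → Bool
  headOK a []      = true
  headOK a (b ∷ v) = before h a b

  row : Vec ℕ l → Bool
  row []      = true
  row (a ∷ v) = headOK a v ∧ row v

  -- A lower row longer than the upper one is rejected as well, so the test contains the condition
  -- on lengths that `above-pad` extracts.
  above : Vec ℕ k → Vec ℕ l → Bool
  above u       []      = true
  above []      (b ∷ v) = false
  above (a ∷ u) (b ∷ v) = before (not ∘ h) a b ∧ above u v

  col : Bool → Vec ℕ k → Vec ℕ l → Bool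
  col false u       v       = above u v
  col true  u       []      = true
  col true  []      (b ∷ v) = false
  col true  (a ∷ u) (b ∷ v) = above u (b ∷ v)

  col-[] : ∀ s (u : Vec ℕ k) → col s u [] ≡ true
  col-[] false u = ≡.refl
  col-[] true  u = ≡.refl

  headOK-pad : ∀ {a} (v : Vec ℕ q) → q ℕ.≤ l → a ℕ.< m → headOK a (pad m l v) ≡ headOK a v
  headOK-pad {l = zero}  []      ℕ.z≤n       a<m = ≡.refl
  headOK-pad {l = suc l} []      ℕ.z≤n       a<m = before-< h a<m
  headOK-pad (b ∷ v) (ℕ.s≤s q≤l) a<m = ≡.refl

  -- The largest letter m may stand below any smaller letter and never above one; it may stand above
  -- itself exactly when `h m` fails. So if `h m` holds, the lower row must end within the p small
  -- letters of the upper row, and otherwise anywhere within its k boxes.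
  above-pad : ∀ {u : Vec ℕ p} {v : Vec ℕ q} → p ℕ.≤ k → q ℕ.≤ l → All (ℕ._< m) u → All (ℕ._< m) v →
              above (pad m k u) (pad m l v) ≡ (l <ᵇ suc (if h m then p else k)) ∧ above u v
  above-pad {l = zero} p≤k ℕ.z≤n us [] = ≡.refl
  above-pad {k = zero} {l = suc l} {m = m} {v = v} ℕ.z≤n q≤l [] vs with h m | v
  ... | true  | []    = ≡.refl
  ... | true  | _ ∷ _ = ≡.refl
  ... | false | []    = ≡.refl
  ... | false | _ ∷ _ = ≡.refl
  above-pad {k = suc k} {l = suc l} {m = m} p≤k q≤l [] []
    rewrite before-≡ (not ∘ h) m with h m in eq
  ... | true  = ≡.refl
  ... | false = ≡.trans (above-pad {k = k} {l = l} {u = []} ℕ.z≤n ℕ.z≤n [] [])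
                        (≡.cong (λ b → (l <ᵇ suc (if b then 0 else k)) ∧ true) eq)
  above-pad {k = suc k} {l = suc l} {m = m} p≤k q≤l [] (b<m ∷ vs)
    rewrite before-> (not ∘ h) b<m = ≡.sym (∧-zeroʳ _)
  above-pad {p = suc p} {k = suc k} {l = suc l} {m = m} (ℕ.s≤s p≤k) q≤l (a<m ∷ us) []
    rewrite before-< (not ∘ h) a<m = ≡.trans (above-pad {l = l} p≤k ℕ.z≤n us []) (lemma (h m))
    where
    lemma : ∀ b → (l <ᵇ suc (if b then p else k)) ∧ true ≡ (suc l <ᵇ suc (if b then suc p else suc k)) ∧ true
    lemma true  = ≡.refl
    lemma false = ≡.refl
  above-pad {p = suc p} {k = suc k} {l = suc l} {m = m} {u = a ∷ u} {b ∷ v} (ℕ.s≤s p≤k) (ℕ.s≤s q≤l) (a<m ∷ us) (b<m ∷ vs) =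
    ≡.trans (≡.cong (before (not ∘ h) a b ∧_) (above-pad p≤k q≤l us vs)) (lemma (before (not ∘ h) a b) (h m))
    where
    lemma : ∀ s b {c} → s ∧ (l <ᵇ suc (if b then p else k)) ∧ c ≡ (suc l <ᵇ suc (if b then suc p else suc k)) ∧ s ∧ c
    lemma true  true  = ≡.refl
    lemma true  false = ≡.refl
    lemma false b     = ≡.sym (∧-zeroʳ _)

  col-pad : ∀ s {u : Vec ℕ p} {v : Vec ℕ q} → p ℕ.≤ k → q ℕ.≤ l → All (ℕ._< m) u → All (ℕ._< m) v →
            col s (pad m k u) (pad m l v) ≡ lt s l (if h m then p else k) ∧ col s u v
  col-pad false p≤k q≤l us vs = above-pad p≤k q≤l us vs
  col-pad {l = zero} true p≤k ℕ.z≤n us [] = ≡.refl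
  col-pad {k = zero} {l = suc l} {m = m} true {v = v} ℕ.z≤n q≤l [] vs with h m | v
  ... | true  | []    = ≡.refl
  ... | true  | _ ∷ _ = ≡.refl
  ... | false | []    = ≡.refl
  ... | false | _ ∷ _ = ≡.refl
  col-pad {k = suc k} {l = suc l} {m = m} true {v = v} p≤k q≤l [] vs =
    ≡.trans (push v) (≡.trans (above-pad {k = k} {u = []} ℕ.z≤n q≤l [] vs) (lemma (h m) v))
    where
    push : ∀ {q} (v : Vec ℕ q) → col true (pad m (suc k) []) (pad m (suc l) v) ≡ above (pad m k []) (pad m (suc l) v)
    push []      = ≡.refl
    push (_ ∷ _) = ≡.refl
    lemma : ∀ b {q} (v : Vec ℕ q) → (suc l <ᵇ suc (if b then 0 else k)) ∧ above [] v
                                  ≡ (suc l <ᵇ (if b then 0 else suc k)) ∧ col true [] v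
    lemma true  []      = ≡.refl
    lemma true  (_ ∷ _) = ≡.refl
    lemma false []      = ≡.refl
    lemma false (_ ∷ _) = ≡.refl
  col-pad {p = suc p} {k = suc k} {l = suc l} {m = m} true {u = a ∷ u} {v} (ℕ.s≤s p≤k) q≤l (a<m ∷ us) vs =
    ≡.trans (push v) (≡.trans (above-pad p≤k q≤l us vs) (lemma (h m) v))
    where
    push : ∀ {q} (v : Vec ℕ q) → col true (pad m (suc k) (a ∷ u)) (pad m (suc l) v) ≡ above (pad m k u) (pad m (suc l) v)
    push []      = ≡.refl
    push (_ ∷ _) = ≡.refl
    lemma : ∀ b {q} (v : Vec ℕ q) → (suc l <ᵇ suc (if b then p else k)) ∧ above u v
                                  ≡ (suc l <ᵇ (if b then suc p else suc k)) ∧ col true (a ∷ u) v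
    lemma true  []      = ≡.refl
    lemma true  (_ ∷ _) = ≡.refl
    lemma false []      = ≡.refl
    lemma false (_ ∷ _) = ≡.refl

-- A largest letter that may not be repeated along rows occupies at most one box
-- of each row.

fits : Bool → ℕ → ℕ → Bool
fits h q l = h ∨ (l <ᵇ suc (suc q))

-- Removal of the largest letter as an operator on generating functions.

module Branch {c ℓ} (R : CommutativeRing c ℓ) where

  open CommutativeRing R hiding (zero)
  open FactorialSchur R
  open Sums R
  open Linear
  open import Algebra.Solver.Ring.NaturalCoefficients.Default commutativeSemiring
    using (solve; _:=_; _:+_; _:*_)
  open import Relation.Binary.Reasoning.Setoid setoid

  ∑-words-suc : ∀ {A : Set} (as : List A) k (f : Vec A (suc k) → Carrier) →
                ∑ (words as (suc k)) f ≈ ∑ as (λ a → ∑ (words as k) (λ v → f (a ∷ v)))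
  ∑-words-suc as k f = ∑-cartesian _∷_ as

  ∑-words-cong : ∀ k {f g : Vec ℕ k → Carrier} → (∀ v → All (ℕ._< m) v → f v ≈ g v) →
                 ∑ (words (downFrom m) k) f ≈ ∑ (words (downFrom m) k) g
  ∑-words-cong         zero    eq = +-congʳ (eq [] [])
  ∑-words-cong {m = m} (suc k) eq =
    trans (∑-words-suc (downFrom m) k _)
   (trans (∑<-cong m λ a a<m → ∑-words-cong k λ v vs → eq (a ∷ v) (a<m ∷ vs))
          (sym (∑-words-suc (downFrom m) k _)))

  rowWt : (ℕ → ℕ → Carrier) → Vec ℕ l → Carrier
  rowWt w []      = 1#
  rowWt w (a ∷ v) = w 0 a * rowWt (w ∘ suc) v

  rowWt-pad : ∀ w {v : Vec ℕ q} → q ℕ.≤ l → rowWt w (pad m l v) ≈ rowWt w v * ∏[ q , l ⟩ (λ j → w j m)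
  rowWt-pad {l = zero}  w {[]}    ℕ.z≤n       = sym (*-identityˡ _)
  rowWt-pad {l = suc l} w {[]}    ℕ.z≤n       =
    trans (*-congˡ (trans (rowWt-pad {l = l} (w ∘ suc) {[]} ℕ.z≤n) (*-identityˡ _))) (sym (*-identityˡ _))
  rowWt-pad             w {a ∷ v} (ℕ.s≤s q≤l) =
    trans (*-congˡ (rowWt-pad (w ∘ suc) q≤l)) (sym (*-assoc _ _ _))

  module Tableaux (h : ℕ → Bool) (s : Bool) where

    open Shape h

    -- Induction on the first letter. If it is m, no smaller letter can follow and only q = 0
    -- survives (`top`); if it is smaller, it becomes the first of the small letters and q grows by
    -- one (`lower`).
    ∑-rows : ∀ m l (f : Vec ℕ l → Carrier) →
             ∑ (words (downFrom (suc m)) l) (λ v → ⟦ row v ⟧ * f v)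
             ≈ ∑ (downFrom (suc l)) (λ q → ⟦ fits (h m) q l ⟧ * ∑ (words (downFrom m) q) (λ v → ⟦ row v ⟧ * f (pad m l v)))
    ∑-rows m zero f with h m
    ... | true  = +-congʳ (sym (trans (*-identityˡ _) (+-identityʳ _)))
    ... | false = +-congʳ (sym (trans (*-identityˡ _) (+-identityʳ _)))
    ∑-rows m (suc l) f = begin
      ∑ (words (downFrom (suc m)) (suc l)) (λ v → ⟦ row v ⟧ * f v)
        ≈⟨ ∑-words-suc (downFrom (suc m)) l _ ⟩
      ∑ (downFrom (suc m)) (λ a → ∑ (words (downFrom (suc m)) l) (λ v → ⟦ headOK a v ∧ row v ⟧ * f (a ∷ v)))
        ≈⟨ ∑-cong (downFrom (suc m)) (λ a → trans (∑-cong (words (downFrom (suc m)) l) λ v → trans (*-congʳ (⟦∧⟧ (headOK a v) (row v))) (swap _ _ _))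
                                                   (∑-rows m l (λ v → ⟦ headOK a v ⟧ * f (a ∷ v)))) ⟩
      ∑ (downFrom (suc m)) (λ a → ∑ (downFrom (suc l)) (λ q → ⟦ fits (h m) q l ⟧ * K a q))
        ≈⟨ +-cong top lower ⟩
      ⟦ fits (h m) 0 (suc l) ⟧ * M 0 + ∑ (downFrom (suc l)) (λ q → ⟦ fits (h m) q l ⟧ * M (suc q))
        ≈⟨ sym (∑<-suc (suc l) _) ⟩
      ∑ (downFrom (suc (suc l))) (λ q → ⟦ fits (h m) q (suc l) ⟧ * M q)  ∎
      where
      swap : ∀ u v w → (u * v) * w ≈ v * (u * w)
      swap = solve 3 (λ u v w → (u :* v) :* w := v :* (u :* w)) refl

      K : ℕ → ℕ → Carrier
      K a q = ∑ (words (downFrom m) q) (λ v → ⟦ row v ⟧ * (⟦ headOK a (pad m l v) ⟧ * f (a ∷ pad m l v)))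

      M : ℕ → Carrier
      M q = ∑ (words (downFrom m) q) (λ v → ⟦ row v ⟧ * f (pad m (suc l) v))

      top : ∑ (downFrom (suc l)) (λ q → ⟦ fits (h m) q l ⟧ * K m q) ≈ ⟦ fits (h m) 0 (suc l) ⟧ * M 0
      top = begin
        ∑ (downFrom (suc l)) (λ q → ⟦ fits (h m) q l ⟧ * K m q)
          ≈⟨ ∑<-suc l _ ⟩
        ⟦ fits (h m) 0 l ⟧ * K m 0 + ∑ (downFrom l) (λ q → ⟦ fits (h m) (suc q) l ⟧ * K m (suc q))
          ≈⟨ +-cong first (trans (∑<-cong l λ q q<l → trans (*-congˡ (vanish q q<l)) (zeroʳ _)) (∑-0 (downFrom l))) ⟩
        ⟦ fits (h m) 0 (suc l) ⟧ * M 0 + 0#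
          ≈⟨ +-identityʳ _ ⟩
        ⟦ fits (h m) 0 (suc l) ⟧ * M 0 ∎
        where
        bools : ∀ l → fits (h m) 0 l ∧ headOK m (pad m l []) ≡ fits (h m) 0 (suc l)
        bools zero with h m
        ... | true  = ≡.refl
        ... | false = ≡.refl
        bools (suc l) rewrite before-≡ h m with h m
        ... | true  = ≡.refl
        ... | false = ∧-zeroʳ _

        first : ⟦ fits (h m) 0 l ⟧ * K m 0 ≈ ⟦ fits (h m) 0 (suc l) ⟧ * M 0
        first = begin
          ⟦ fits (h m) 0 l ⟧ * (1# * (⟦ headOK m (pad m l []) ⟧ * f _) + 0#)
            ≈⟨ *-congˡ (trans (+-identityʳ _) (*-identityˡ _)) ⟩
          ⟦ fits (h m) 0 l ⟧ * (⟦ headOK m (pad m l []) ⟧ * f _)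
            ≈⟨ trans (sym (*-assoc _ _ _)) (*-congʳ (sym (⟦∧⟧ (fits (h m) 0 l) _))) ⟩
          ⟦ fits (h m) 0 l ∧ headOK m (pad m l []) ⟧ * f _
            ≈⟨ *-cong (reflexive (≡.cong ⟦_⟧ (bools l))) (sym (trans (+-identityʳ _) (*-identityˡ _))) ⟩
          ⟦ fits (h m) 0 (suc l) ⟧ * M 0 ∎

        vanish : ∀ q → q ℕ.< l → K m (suc q) ≈ 0#
        vanish q (ℕ.s≤s q≤l) = trans (∑-words-cong {m = m} (suc q) λ { (b ∷ v) (b<m ∷ vs) →
            trans (*-congˡ (trans (*-congʳ (reflexive (≡.cong ⟦_⟧ (before-> h b<m)))) (zeroˡ _))) (zeroʳ _) })
          (∑-0 (words (downFrom m) (suc q)))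

      lower : ∑ (downFrom m) (λ a → ∑ (downFrom (suc l)) (λ q → ⟦ fits (h m) q l ⟧ * K a q))
              ≈ ∑ (downFrom (suc l)) (λ q → ⟦ fits (h m) q l ⟧ * M (suc q))
      lower = begin
        ∑ (downFrom m) (λ a → ∑ (downFrom (suc l)) (λ q → ⟦ fits (h m) q l ⟧ * K a q))
          ≈⟨ sums (sum-linear (downFrom m)) (downFrom (suc l)) _ (λ q a → K a q) ⟩
        ∑ (downFrom (suc l)) (λ q → ⟦ fits (h m) q l ⟧ * ∑ (downFrom m) (λ a → K a q))
          ≈⟨ ∑<-cong (suc l) (λ q q<l → *-congˡ (trans
               (∑<-cong m λ a a<m → ∑-words-cong q λ v vs → trans
                 (*-congˡ (*-congʳ (reflexive (≡.cong ⟦_⟧ (headOK-pad v (ℕₚ.≤-pred q<l) a<m)))))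
                 (trans (sym (swap _ _ _)) (*-congʳ (sym (⟦∧⟧ (headOK a v) (row v))))))
               (sym (∑-words-suc (downFrom m) q _)))) ⟩
        ∑ (downFrom (suc l)) (λ q → ⟦ fits (h m) q l ⟧ * M (suc q)) ∎

    module _ (W : ℕ → ℕ → ℕ → Carrier) where

      -- The generating function of the tableaux of shape ν over the m smallest
      -- letters, where i is the index of the first row and φ the condition imposed
      -- on it by the row above.

      S : ℕ → ℕ → (∀ {l} → Vec ℕ l → Bool) → Vec ℕ n → Carrier
      S m i φ []      = 1#
      S m i φ (l ∷ ν) = ∑ (words (downFrom m) l) λ v →
        ⟦ row v ⟧ * (⟦ φ v ⟧ * (rowWt (W i) v * S m (suc i) (col s v) ν))

      S-empty : ∀ {i j} {ν : Vec ℕ n} {φ : ∀ {l} → Vec ℕ l → Bool} → Part 1 j ν → S 0 i φ ν ≈ 0#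
      S-empty {ν = suc l ∷ ν}         (here _)  = refl
      S-empty {i = i} {ν = suc l ∷ ν} (there p) = refl
      S-empty {i = i} {ν = zero ∷ ν}  (there p) =
        trans (+-identityʳ _) (trans (*-identityˡ _) (trans (*-congˡ (trans (*-identityˡ _) (S-empty {i = suc i} p))) (zeroʳ _)))

      -- Drops the last row once a removal has emptied it, so that rows and letters are again equal
      -- in number.
      S-∷ʳ0 : ∀ m i (φ : ∀ {l} → Vec ℕ l → Bool) → φ [] ≡ true → (ν : Vec ℕ n) → S m i φ (ν ∷ʳ 0) ≈ S m i φ ν
      S-∷ʳ0 m i φ φ[] []      = trans (+-identityʳ _) (trans (*-identityˡ _)
        (trans (*-cong (reflexive (≡.cong ⟦_⟧ φ[])) (*-identityˡ _)) (*-identityˡ _)))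
      S-∷ʳ0 m i φ φ[] (l ∷ ν) = ∑-cong (words (downFrom m) l) λ v →
        *-congˡ (*-congˡ (*-congˡ (S-∷ʳ0 m (suc i) (col s v) (col-[] s v) ν)))

  module Strips (h s : Bool) (w : ℕ → ℕ → Carrier) where

    -- Nothing can stand below a largest letter that repeats along rows, so the next row has to fit
    -- under the q remaining boxes; otherwise it may extend under all l boxes.
    next : ℕ → ℕ → ℕ → Bool
    next q l l′ = lt s l′ (if h then q else l)

    -- The sum over the shapes κ left by deleting the boxes of a strip filled with
    -- the largest letter; w weighs the deleted boxes.

    B : ℕ → (ℕ → Bool) → Vec ℕ n → (Vec ℕ n → Carrier) → Carrier
    B i ψ []      g = g []
    B i ψ (l ∷ ν) g = ⟦ ψ l ⟧ * ∑ (downFrom (suc l)) λ q →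
      ⟦ fits h q l ⟧ * (∏[ q , l ⟩ (w i) * B (suc i) (next q l) ν (g ∘ (q ∷_)))

    B-linear : ∀ i ψ (ν : Vec ℕ n) → Linear (B i ψ ν)
    B-linear i ψ []      = eval-linear []
    B-linear i ψ (l ∷ ν) = *-linear _ (∑-linear (downFrom (suc l)) λ q →
      *-linear _ (*-linear _ (∘-linear (q ∷_) (B-linear (suc i) (next q l) ν))))

    data Strip : (ℕ → Bool) → Vec ℕ n → Vec ℕ n → Set where
      []  : ∀ {ψ} → Strip ψ [] []
      _∷_ : ∀ {ψ q l} {ν κ : Vec ℕ n} → (T (ψ l) × q ℕ.≤ l × T (fits h q l)) →
            Strip (next q l) ν κ → Strip ψ (l ∷ ν) (q ∷ κ)

    B-cong : ∀ i ψ (ν : Vec ℕ n) {g g′} → (∀ κ → Strip ψ ν κ → g κ ≈ g′ κ) → B i ψ ν g ≈ B i ψ ν g′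
    B-cong i ψ []      eq = eq [] []
    B-cong i ψ (l ∷ ν) eq = ⟦⟧-cong (ψ l) λ ψl → ∑<-cong (suc l) λ q q<l → ⟦⟧-cong (fits h q l) λ ok →
      *-congˡ (B-cong (suc i) (next q l) ν λ κ st → eq (q ∷ κ) ((ψl , ℕₚ.≤-pred q<l , ok) ∷ st))

  module Removal (h : ℕ → Bool) (s : Bool) (W : ℕ → ℕ → ℕ → Carrier) where

    open Shape h
    open Tableaux h s

    -- The condition imposed by the row above splits, on a padded row, into a condition `ψ` on the
    -- length and a condition `φ′` on the small letters. `col-pad` reproduces this splitting for the
    -- next row, which lets the induction run down the shape.
    branch : ∀ m i (φ φ′ : ∀ {l} → Vec ℕ l → Bool) ψ →
             (∀ {q l} (v : Vec ℕ q) → q ℕ.≤ l → All (ℕ._< m) v → φ (pad m l v) ≡ ψ l ∧ φ′ v) →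
             (ν : Vec ℕ n) →
             S W (suc m) i φ ν ≈ Strips.B (h m) s (λ i j → W i j m) i ψ ν (S W m i φ′)
    branch m i φ φ′ ψ eq []      = refl
    branch m i φ φ′ ψ eq (l ∷ ν) = begin
      ∑ (words (downFrom (suc m)) l) (λ v → ⟦ row v ⟧ * (⟦ φ v ⟧ * (rowWt (W i) v * S W (suc m) (suc i) (col s v) ν)))
        ≈⟨ ∑-rows m l _ ⟩
      ∑ (downFrom (suc l)) (λ q → ⟦ fits (h m) q l ⟧ * ∑ (words (downFrom m) q) (λ v → ⟦ row v ⟧ *
        (⟦ φ (pad m l v) ⟧ * (rowWt (W i) (pad m l v) * S W (suc m) (suc i) (col s (pad m l v)) ν))))
        ≈⟨ ∑<-cong (suc l) (λ q q<l → *-congˡ (∑-words-cong q λ v vs → *-congˡ (*-cong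
             (trans (reflexive (≡.cong ⟦_⟧ (eq v (ℕₚ.≤-pred q<l) vs))) (⟦∧⟧ (ψ l) (φ′ v)))
             (*-cong (rowWt-pad (W i) (ℕₚ.≤-pred q<l))
               (branch m (suc i) (col s (pad m l v)) (col s v) (next q l)
                 (λ v′ q′≤l′ vs′ → col-pad s (ℕₚ.≤-pred q<l) q′≤l′ vs vs′) ν))))) ⟩
      ∑ (downFrom (suc l)) (λ q → ⟦ fits (h m) q l ⟧ * ∑ (words (downFrom m) q) (λ v → ⟦ row v ⟧ *
        ((⟦ ψ l ⟧ * ⟦ φ′ v ⟧) * ((rowWt (W i) v * P q) * B (suc i) (next q l) ν (S W m (suc i) (col s v))))))
        ≈⟨ ∑-cong (downFrom (suc l)) (λ q → *-congˡ (trans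
             (∑-cong (words (downFrom m) q) λ v →
               solve 6 (λ r y f t p b → r :* ((y :* f) :* ((t :* p) :* b)) := (y :* p) :* ((r :* (f :* t)) :* b)) refl _ _ _ _ _ _)
             (trans (scale (sum-linear (words (downFrom m) q)) _ _)
                    (*-congˡ (sym (sums (B-linear (suc i) (next q l) ν) (words (downFrom m) q) _ _)))))) ⟩
      ∑ (downFrom (suc l)) (λ q → ⟦ fits (h m) q l ⟧ * ((⟦ ψ l ⟧ * P q) *
        B (suc i) (next q l) ν (λ κ → ∑ (words (downFrom m) q) (λ v → (⟦ row v ⟧ * (⟦ φ′ v ⟧ * rowWt (W i) v)) * S W m (suc i) (col s v) κ))))
        ≈⟨ ∑-cong (downFrom (suc l)) (λ q → trans
             (solve 4 (λ o y p b → o :* ((y :* p) :* b) := y :* (o :* (p :* b))) refl _ _ _ _)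
             (*-congˡ (*-congˡ (*-congˡ (B-linear (suc i) (next q l) ν .cong λ κ → ∑-cong (words (downFrom m) q) λ v →
               solve 4 (λ r f t z → (r :* (f :* t)) :* z := r :* (f :* (t :* z))) refl _ _ _ _))))) ⟩
      ∑ (downFrom (suc l)) (λ q → ⟦ ψ l ⟧ * (⟦ fits (h m) q l ⟧ * (P q * B (suc i) (next q l) ν (λ κ → S W m i φ′ (q ∷ κ)))))
        ≈⟨ scale (sum-linear (downFrom (suc l))) _ _ ⟩
      ⟦ ψ l ⟧ * ∑ (downFrom (suc l)) (λ q → ⟦ fits (h m) q l ⟧ * (P q * B (suc i) (next q l) ν (λ κ → S W m i φ′ (q ∷ κ)))) ∎
      where
      open Strips (h m) s (λ i j → W i j m)
      P : ℕ → Carrier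
      P q = ∏[ q , l ⟩ (λ j → W i j m)

    -- The parity of k * 2 does not compute for a variable k, so the type of the top letter and its
    -- weights enter as proved equations.
    branch-top : ∀ m i (φ φ′ : ∀ {l} → Vec ℕ l → Bool) ψ {b w} → h m ≡ b → (∀ i j → W i j m ≈ w i j) →
              (∀ {q l} (v : Vec ℕ q) → q ℕ.≤ l → All (ℕ._< m) v → φ (pad m l v) ≡ ψ l ∧ φ′ v) →
              (ν : Vec ℕ n) →
              S W (suc m) i φ ν ≈ Strips.B b s w i ψ ν (S W m i φ′)
    branch-top m i φ φ′ ψ {w = w} ≡.refl W≈w eq ν =
      trans (branch m i φ φ′ ψ eq ν) (B-weights i ψ ν _)
      where
      B-weights : ∀ {n} i ψ (ν : Vec ℕ n) g →
                  Strips.B (h m) s (λ i j → W i j m) i ψ ν g ≈ Strips.B (h m) s w i ψ ν g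
      B-weights i ψ []      g = refl
      B-weights i ψ (l ∷ ν) g = *-congˡ (∑-cong (downFrom (suc l)) λ q → *-congˡ
        (*-cong (interval-cong q l (W≈w i)) (B-weights (suc i) _ ν (g ∘ (q ∷_)))))

-- The removal operators expressed through `H` and `V`.

<ᵇ-+ : ∀ a b N → (a ℕ.+ N <ᵇ b ℕ.+ N) ≡ (a <ᵇ b)
<ᵇ-+ a b zero    rewrite ℕₚ.+-identityʳ a | ℕₚ.+-identityʳ b = ≡.refl
<ᵇ-+ a b (suc N) rewrite ℕₚ.+-suc a N | ℕₚ.+-suc b N = <ᵇ-+ a b N

byRank : ∀ {ℓ} {A : Set ℓ} → (ℕ → A) → (ℕ → A) → ℕ → A
byRank p u zero          = p 0
byRank p u (suc zero)    = u 0
byRank p u (suc (suc r)) = byRank (p ∘ suc) (u ∘ suc) r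

byRank-even : ∀ {ℓ} {A : Set ℓ} (p u : ℕ → A) k → byRank p u (k ℕ.* 2) ≡ p k
byRank-even p u zero    = ≡.refl
byRank-even p u (suc k) = byRank-even (p ∘ suc) (u ∘ suc) k

byRank-odd : ∀ {ℓ} {A : Set ℓ} (p u : ℕ → A) k → byRank p u (suc (k ℕ.* 2)) ≡ u k
byRank-odd p u zero    = ≡.refl
byRank-odd p u (suc k) = byRank-odd (p ∘ suc) (u ∘ suc) k

isOdd : ℕ → Bool
isOdd = byRank (const false) (const true)

lt-mono : ∀ l {r p} → r ℕ.≤ l → T (lt true l p) → T (lt true r p)
lt-mono l       {zero}      r≤l l<p = tt
lt-mono (suc l) {suc r} {p} r≤l l<p = ℕₚ.<⇒<ᵇ (ℕₚ.≤-<-trans r≤l (ℕₚ.<ᵇ⇒< (suc l) p l<p))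

module Evaluate {c ℓ} (R : CommutativeRing c ℓ) where

  open CommutativeRing R hiding (zero)
  open FactorialSchur R
  open Sums R
  open Linear
  open Branch R
  open Strips using ([]; _∷_)
  open import Algebra.Solver.Ring.NaturalCoefficients.Default commutativeSemiring
    using (solve; _:=_; _:+_; _:*_; con)
  open import Relation.Binary.Reasoning.Setoid setoid

  -- Row i keeps enough boxes to cover row i + 1. The bounds t and t′ are separate because covering
  -- is strict in shifted shapes.
  strip-part : ∀ {s w t t′ i ψ} {ν κ : Vec ℕ n} → (∀ {l q} → t ℕ.≤ l → T (lt s l q) → t′ ℕ.≤ q) →
               Strips.Strip true s w ψ ν κ → Part t (suc i) ν → Part t′ i κ
  strip-part f (_ ∷ []) (there ())
  strip-part         f (_ ∷ (l≤q , _) ∷ _)   (there (here t≤l)) = here (f t≤l l≤q)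
  strip-part {i = suc i} f (_ ∷ st)                 (there (there p))  = there (strip-part f st (there p))

  strip-part′ : ∀ {s w t i ψ} {ν κ : Vec ℕ n} →
                Strips.Strip false s w ψ ν κ → Part (suc t) i ν → Part t i κ
  strip-part′ {t = t} {ν = l ∷ _} {q ∷ _} ((_ , _ , ok) ∷ _) (here t<l) =
    here (ℕₚ.≤-pred (ℕₚ.≤-trans t<l (ℕₚ.≤-pred (ℕₚ.<ᵇ⇒< l (suc (suc q)) ok))))
  strip-part′ (_ ∷ st) (there p) = there (strip-part′ st p)

  module _ (a : ℕ → Carrier) where

    open Operators a

    interval-+ : ∀ q l N f → ∏[ q ℕ.+ N , l ℕ.+ N ⟩ f ≈ ∏[ q , l ⟩ (λ j → f (j ℕ.+ N))
    interval-+ q l zero f rewrite ℕₚ.+-identityʳ q | ℕₚ.+-identityʳ l =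
      interval-cong q l λ j → reflexive (≡.cong f (≡.sym (ℕₚ.+-identityʳ j)))
    interval-+ q l (suc N) f rewrite ℕₚ.+-suc q N | ℕₚ.+-suc l N =
      trans (interval-+ q l N (f ∘ suc)) (interval-cong q l λ j → reflexive (≡.cong f (≡.sym (ℕₚ.+-suc j N))))

    ∑<-+ : ∀ k N (f : ℕ → Carrier) → (∀ r → r ℕ.< N → f r ≈ 0#) →
           ∑ (downFrom (k ℕ.+ N)) f ≈ ∑ (downFrom k) (λ r → f (r ℕ.+ N))
    ∑<-+ zero    N f eq = trans (∑<-cong N eq) (∑-0 (downFrom N))
    ∑<-+ (suc k) N f eq = +-congˡ (∑<-+ k N f eq)

    ∑<-first : ∀ k (f : ℕ → Carrier) → (∀ r → f (suc r) ≈ 0#) → ∑ (downFrom (suc k)) f ≈ f 0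
    ∑<-first k f eq = trans (∑<-suc k f)
      (trans (+-congˡ (trans (∑-cong (downFrom k) eq) (∑-0 (downFrom k)))) (+-identityʳ _))

    module Semistandard (x : ℕ → Carrier) where

      -- All of i, j, k count from 0, so k + j - i in 1-based terms becomes k + (j + 1) - i.
      W : ℕ → ℕ → ℕ → Carrier
      W i j k = x k + a (k ℕ.+ suc j ∸ i)

      open Tableaux (const true) false
      open Removal (const true) false W

      G : ℕ → Vec ℕ n → Carrier
      G m = S W m 0 (const true)

      module _ (m : ℕ) where

        open Strips true false (λ i j → W i j m)

        -- The equation i + N = m says that the rows still to come, N besides row i, match the
        -- letter m. It makes the index of a equal to j shifted by the entry of δ in row i, so the
        -- removed boxes of that row carry a_d for exactly the d between the parts of κ and λ.
        strip-H : ∀ N i ψ → i ℕ.+ N ≡ m → ∀ l (ν : Vec ℕ N) g g′ →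
              (∀ κ → Part 1 N κ → g κ ≈ 0#) → (∀ κ → g (κ ∷ʳ 0) ≈ g′ (κ ⊕ δ N)) →
              B i ψ (l ∷ ν) g ≈ ⟦ ψ l ⟧ * H (x m) ((l ∷ ν) ⊕ δ (suc N)) g′
        strip-H zero i ψ i+0≡m l [] g g′ g-vanish g≈g′ rewrite ℕₚ.+-comm l 1 = *-congˡ (begin
          ∑ (downFrom (suc l)) (λ q → 1# * (∏[ q , l ⟩ (w i) * g (q ∷ [])))
            ≈⟨ ∑<-first l _ (λ r → trans (*-identityˡ _) (trans (*-congˡ (g-vanish _ (here (ℕ.s≤s ℕ.z≤n)))) (zeroʳ _))) ⟩
          1# * (∏[ 0 , l ⟩ (w i) * g (0 ∷ []))
            ≈⟨ trans (*-identityˡ _) (*-cong (interval-cong 0 l λ j → +-congˡ (reflexive (≡.cong a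
                 (≡.trans (≡.cong (λ m → m ℕ.+ suc j ∸ i) (≡.trans (≡.sym i+0≡m) (ℕₚ.+-identityʳ i))) (ℕₚ.m+n∸m≡n i (suc j))))))
                 (g≈g′ [])) ⟩
          ∏[ 0 , l ⟩ (λ j → x m + a (suc j)) * g′ [] ∎)
          where
          w : ℕ → ℕ → Carrier
          w i j = W i j m
        strip-H (suc N) i ψ i+N≡m l (l′ ∷ ν) g g′ g-vanish g≈g′ rewrite ℕₚ.+-suc l (suc N) = *-congˡ (begin
          ∑ (downFrom (suc l)) (λ q → 1# * (∏[ q , l ⟩ (w i) * B (suc i) (next q l) (l′ ∷ ν) (g ∘ (q ∷_))))
            ≈⟨ ∑-cong (downFrom (suc l)) (λ q → trans (*-identityˡ _) (trans (*-cong
                 (trans (interval-cong q l λ j → +-congˡ (reflexive (≡.cong a (index j)))) (sym (interval-+ q l (suc N) _)))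
                 (strip-H N (suc i) (next q l) (≡.trans (≡.sym (ℕₚ.+-suc i N)) i+N≡m) l′ ν (g ∘ (q ∷_)) (g′ ∘ (q ℕ.+ suc N ∷_))
                   (λ κ p → g-vanish (q ∷ κ) (there p)) (λ κ → g≈g′ (q ∷ κ))))
                 (solve 3 (λ p b h → p :* (b :* h) := b :* (p :* h)) refl _ _ _))) ⟩
          ∑ (downFrom (suc l)) (λ q → ⟦ l′ <ᵇ suc q ⟧ * (∏[ q ℕ.+ suc N , l ℕ.+ suc N ⟩ (λ j → x m + a (suc j)) *
             H (x m) ((l′ ∷ ν) ⊕ δ (suc N)) (g′ ∘ (q ℕ.+ suc N ∷_))))
            ≈⟨ ∑-cong (downFrom (suc l)) (λ q → *-congʳ (reflexive (≡.cong ⟦_⟧ (≡.sym (<ᵇ-+ l′ (suc q) (suc N)))))) ⟩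
          ∑ (downFrom (suc l)) (λ q → F (q ℕ.+ suc N))
            -- After the shift by δ, r starts at N + 1; smaller r lie below the next part and
            -- contribute nothing to `H`.
            ≈⟨ sym (∑<-+ (suc l) (suc N) F λ r r≤N → trans
                 (*-congʳ (reflexive (≡.cong ⟦_⟧ (<ᵇ-false (ℕₚ.≤-trans r≤N (ℕₚ.m≤n+m (suc N) l′)))))) (zeroˡ _)) ⟩
          ∑ (downFrom (suc l ℕ.+ suc N)) F ∎)
          where
          w : ℕ → ℕ → Carrier
          w i j = W i j m
          F : ℕ → Carrier
          F r = ⟦ l′ ℕ.+ suc N <ᵇ suc r ⟧ * (∏[ suc r , suc (l ℕ.+ suc N) ⟩ (λ d → x m + a d) *
            H (x m) ((l′ ∷ ν) ⊕ δ (suc N)) (g′ ∘ (r ∷_)))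
          index : ∀ j → m ℕ.+ suc j ∸ i ≡ suc (j ℕ.+ suc N)
          index j = ≡.trans (≡.cong (λ m → m ℕ.+ suc j ∸ i) (≡.sym i+N≡m))
                   (≡.trans (≡.cong (_∸ i) (ℕₚ.+-assoc i (suc N) (suc j)))
                   (≡.trans (ℕₚ.m+n∸m≡n i (suc N ℕ.+ suc j)) (ℕₚ.+-comm (suc N) (suc j))))

      G-suc : ∀ m (ν : Vec ℕ n) → G (suc m) ν ≈ Strips.B true false (λ i j → W i j m) 0 (const true) ν (G m)
      G-suc m = branch m 0 (const true) (const true) (const true) (λ _ _ _ → ≡.refl)

      -- Each removal leaves row i nonempty if row i + 1 was nonempty, so m letters cannot fill more
      -- than m rows.
      G-vanish : ∀ m {i} {ν : Vec ℕ n} → m ℕ.≤ i → Part 1 i ν → G m ν ≈ 0#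
      G-vanish zero            m≤i         p = S-empty W {i = 0} p
      G-vanish (suc m) {suc i} {ν} (ℕ.s≤s m≤i) p = trans (G-suc m ν) (trans
        (Strips.B-cong true false _ 0 _ ν {g′ = const 0#} λ κ st →
          G-vanish m m≤i (strip-part {t′ = 1} (λ 1≤l l≤q → ℕₚ.≤-trans 1≤l (ℕₚ.≤-pred (ℕₚ.<ᵇ⇒< _ _ l≤q))) st p))
        (zeros (Strips.B-linear true false _ 0 _ ν)))

      G≈Z : ∀ m (ν : Vec ℕ m) → G m ν ≈ Z x (ν ⊕ δ m)
      G≈Z zero    []      = refl
      G≈Z (suc m) (l ∷ ν) = trans (G-suc m (l ∷ ν)) (trans
        (strip-H m m 0 (const true) ≡.refl l ν (G m) (Z x) (λ κ → G-vanish m ℕₚ.≤-refl)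
          (λ κ → trans (S-∷ʳ0 W m 0 (const true) ≡.refl κ) (G≈Z m κ)))
        (*-identityˡ _))

    module PrimedShifted (x y z : ℕ → Carrier) where

      W : ℕ → ℕ → ℕ → Carrier
      W _ zero    = byRank z x
      W _ (suc j) = byRank (λ k → y k - a (suc j)) (λ k → x k + a (suc j))

      open Tableaux isOdd true
      open Removal isOdd true W

      K : ℕ → Vec ℕ n → Carrier
      K m = S W m 0 (const true)

      module _ (x y z : Carrier) where

        wʰ wᵛ : ℕ → ℕ → Carrier
        wʰ _ zero    = x
        wʰ _ (suc j) = x + a (suc j)
        wᵛ _ zero    = z
        wᵛ _ (suc j) = y - a (suc j)

        private
          module Sʰ = Strips true true wʰ
          module Sᵛ = Strips false true wᵛ

        -- Let ρ be the length of a row once the letters n are gone. Above another row ρ = r + 1,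
        -- where r is the summation index of `H`, and at most one n′ in the row leaves r + 1 or r
        -- boxes, the two choices of `V`. The last row must be emptied, which produces x + z. The
        -- hypothesis on `ψ` and `ψ′` makes the fitting condition of the second removal follow from
        -- that of the first.
        strips-HV : ∀ {N} i ψ ψ′ l (ls : Vec ℕ N) → All (0 ℕ.<_) (l ∷ ls) →
                (∀ ρ → T (ψ l) → ρ ℕ.≤ l → T (ψ′ ρ)) → ∀ g g′ →
                (∀ κ → Part 1 N κ → g κ ≈ 0#) → (∀ κ → g (κ ∷ʳ 0) ≈ g′ κ) →
                Sʰ.B i ψ (l ∷ ls) (λ ρs → Sᵛ.B i ψ′ ρs g) ≈
                ⟦ ψ l ⟧ * ((x + z) * H x (l ∷ ls) (λ κ → V y κ g′))
        strips-HV i ψ ψ′ zero ls (() ∷ _)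
        strips-HV i ψ ψ′ (suc l) (zero ∷ ls) (_ ∷ () ∷ _)
        strips-HV i ψ ψ′ (suc l) [] _ ψ⇒ψ′ g g′ g-vanish g≈g′ = ⟦⟧-cong (ψ (suc l)) λ ψl → begin
          ∑ (downFrom (suc (suc l))) (λ ρ → 1# * (∏[ ρ , suc l ⟩ (wʰ i) * (⟦ ψ′ ρ ⟧ *
            ∑ (downFrom (suc ρ)) (λ κ → ⟦ fits false κ ρ ⟧ * (∏[ κ , ρ ⟩ (wᵛ i) * g (κ ∷ []))))))
            ≈⟨ ∑<-cong (suc (suc l)) (λ ρ ρ<l → trans (*-identityˡ _) (*-congˡ (trans (⟦T⟧ (ψ′ ρ) (ψ⇒ψ′ ρ ψl (ℕₚ.≤-pred ρ<l)))
                 (trans (∑<-first ρ _ λ κ → trans (*-congˡ (trans (*-congˡ (g-vanish _ (here (ℕ.s≤s ℕ.z≤n)))) (zeroʳ _))) (zeroʳ _))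
                        (*-congˡ (*-congˡ (g≈g′ []))))))) ⟩
          ∑ (downFrom (suc (suc l))) (λ ρ → ∏[ ρ , suc l ⟩ (wʰ i) * (⟦ ρ <ᵇ 2 ⟧ * (∏[ 0 , ρ ⟩ (wᵛ i) * g′ [])))
            -- Only ρ = 0 and ρ = 1 remain: the diagonal box holds n with weight x, or n′ with
            -- weight z.
            ≈⟨ trans (∑<-suc (suc l) _) (+-congˡ (∑<-first l _ λ r → trans (*-congˡ (zeroˡ _)) (zeroʳ _))) ⟩
          (x * P) * (1# * (1# * g′ [])) + P * (1# * ((z * 1#) * g′ []))
            ≈⟨ solve 4 (λ x z p g → (x :* p) :* (con 1 :* (con 1 :* g)) :+ p :* (con 1 :* ((z :* con 1) :* g)) := (x :+ z) :* (p :* g)) refl x z P (g′ []) ⟩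
          (x + z) * (P * g′ []) ∎
          where
          P : Carrier
          P = ∏[ 0 , l ⟩ (λ j → x + a (suc j))
        strips-HV i ψ ψ′ (suc l) (l′@(suc l₀) ∷ ls) (_ ∷ pos) ψ⇒ψ′ g g′ g-vanish g≈g′ = ⟦⟧-cong (ψ (suc l)) λ ψl → begin
          ∑ (downFrom (suc (suc l))) (λ ρ → 1# * (∏[ ρ , suc l ⟩ (wʰ i) *
            Sʰ.B (suc i) (Sʰ.next ρ (suc l)) (l′ ∷ ls) (λ ρs → ⟦ ψ′ ρ ⟧ *
              ∑ (downFrom (suc ρ)) (λ κ → ⟦ fits false κ ρ ⟧ * (∏[ κ , ρ ⟩ (wᵛ i) * Sᵛ.B (suc i) (Sᵛ.next κ ρ) ρs (g ∘ (κ ∷_)))))))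
            ≈⟨ ∑<-cong (suc (suc l)) (λ ρ ρ<l → trans (*-identityˡ _) (*-congˡ (inner ρ (ψ⇒ψ′ ρ ψl (ℕₚ.≤-pred ρ<l))))) ⟩
          ∑ (downFrom (suc (suc l))) (λ ρ → ∏[ ρ , suc l ⟩ (wʰ i) * M ρ)
            -- A row with ρ = 0 cannot cover the nonempty next row; ρ = r + 1 becomes the summand r
            -- of `H`.
            ≈⟨ ∑<-suc (suc l) _ ⟩
          ∏[ 0 , suc l ⟩ (wʰ i) * M 0 + ∑ (downFrom (suc l)) (λ r → ∏[ r , l ⟩ (λ j → x + a (suc j)) * M (suc r))
            ≈⟨ trans (+-congʳ (trans (*-congˡ M0) (zeroʳ _))) (+-identityˡ _) ⟩
          ∑ (downFrom (suc l)) (λ r → ∏[ r , l ⟩ (λ j → x + a (suc j)) * M (suc r))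
            ≈⟨ ∑-cong (downFrom (suc l)) (λ r → trans (*-congˡ (M-suc r))
                 (solve 4 (λ p b c h → p :* (b :* (c :* h)) := c :* (b :* (p :* h))) refl _ _ (x + z) _)) ⟩
          ∑ (downFrom (suc l)) (λ r → (x + z) * (⟦ l′ <ᵇ suc r ⟧ * (∏[ r , l ⟩ (λ j → x + a (suc j)) * HV′ r)))
            ≈⟨ scale (sum-linear (downFrom (suc l))) _ _ ⟩
          (x + z) * H x (suc l ∷ l′ ∷ ls) (λ κ → V y κ g′) ∎
          where
          HV HV′ : ℕ → Carrier
          HV  κ = H x (l′ ∷ ls) (λ κs → V y κs (g′ ∘ (κ ∷_)))
          HV′ r = H x (l′ ∷ ls) (λ κs → V y (r ∷ κs) g′)

          coeff : ℕ → ℕ → Carrier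
          coeff ρ κ = ⟦ fits false κ ρ ⟧ * ∏[ κ , ρ ⟩ (wᵛ i)

          M : ℕ → Carrier
          M ρ = ∑ (downFrom (suc ρ)) (λ κ → coeff ρ κ * (⟦ lt true l′ ρ ⟧ * ((x + z) * HV κ)))

          inner : ∀ ρ → T (ψ′ ρ) →
            Sʰ.B (suc i) (Sʰ.next ρ (suc l)) (l′ ∷ ls) (λ ρs → ⟦ ψ′ ρ ⟧ *
              ∑ (downFrom (suc ρ)) (λ κ → ⟦ fits false κ ρ ⟧ * (∏[ κ , ρ ⟩ (wᵛ i) * Sᵛ.B (suc i) (Sᵛ.next κ ρ) ρs (g ∘ (κ ∷_)))))
            ≈ M ρ
          inner ρ ψ′ρ = begin
            Bρ (λ ρs → ⟦ ψ′ ρ ⟧ * ∑ (downFrom (suc ρ)) (λ κ → ⟦ fits false κ ρ ⟧ * (∏[ κ , ρ ⟩ (wᵛ i) * U κ ρs)))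
              ≈⟨ lin .cong (λ ρs → trans (⟦T⟧ (ψ′ ρ) ψ′ρ) (∑-cong (downFrom (suc ρ)) λ κ → sym (*-assoc ⟦ fits false κ ρ ⟧ (∏[ κ , ρ ⟩ (wᵛ i)) (U κ ρs)))) ⟩
            Bρ (λ ρs → ∑ (downFrom (suc ρ)) (λ κ → coeff ρ κ * U κ ρs))
              ≈⟨ sums lin (downFrom (suc ρ)) (coeff ρ) U ⟩
            ∑ (downFrom (suc ρ)) (λ κ → coeff ρ κ * Bρ (U κ))
              ≈⟨ ∑-cong (downFrom (suc ρ)) (λ κ → *-congˡ (strips-HV (suc i) (Sʰ.next ρ (suc l)) (Sᵛ.next κ ρ) l′ ls pos (λ ρ′ l′<ρ ρ′≤l′ → lt-mono l′ ρ′≤l′ l′<ρ)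
                   (g ∘ (κ ∷_)) (g′ ∘ (κ ∷_)) (λ κs p → g-vanish (κ ∷ κs) (there p)) (λ κs → g≈g′ (κ ∷ κs)))) ⟩
            M ρ ∎
            where
            Bρ : (Vec ℕ _ → Carrier) → Carrier
            Bρ = Sʰ.B (suc i) (Sʰ.next ρ (suc l)) (l′ ∷ ls)
            lin = Sʰ.B-linear (suc i) (Sʰ.next ρ (suc l)) (l′ ∷ ls)
            U : ℕ → Vec ℕ _ → Carrier
            U κ ρs = Sᵛ.B (suc i) (Sᵛ.next κ ρ) ρs (g ∘ (κ ∷_))

          M0 : M 0 ≈ 0#
          M0 = trans (+-identityʳ _) (trans (*-congˡ (zeroˡ _)) (zeroʳ _))

          -- Only r = 0 would involve the diagonal weight z, and l′ ≤ r excludes it.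
          diagonal-free : ∀ r → T (l′ <ᵇ suc r) → wᵛ i r ≈ y - a r
          diagonal-free (suc r) _ = refl

          M-suc : ∀ r → M (suc r) ≈ ⟦ l′ <ᵇ suc r ⟧ * ((x + z) * HV′ r)
          M-suc r = begin
            M (suc r)
              ≈⟨ ∑-cong (downFrom (suc (suc r))) (λ κ → solve 3 (λ t b h → t :* (b :* h) := b :* (t :* h)) refl _ _ _) ⟩
            ∑ (downFrom (suc (suc r))) (λ κ → ⟦ l′ <ᵇ suc r ⟧ * (coeff (suc r) κ * ((x + z) * HV κ)))
              ≈⟨ scale (sum-linear (downFrom (suc (suc r)))) _ _ ⟩
            ⟦ l′ <ᵇ suc r ⟧ * ∑ (downFrom (suc (suc r))) (λ κ → coeff (suc r) κ * ((x + z) * HV κ))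
              -- Of all κ, only r + 1 (no n′ in the row) and r (one n′) satisfy `fits`.
              ≈⟨ ⟦⟧-cong (l′ <ᵇ suc r) (λ l′≤r → trans (+-cong first (trans (+-cong (second l′≤r) others) (+-identityʳ _))) (sym (distribˡ _ _ _))) ⟩
            ⟦ l′ <ᵇ suc r ⟧ * ((x + z) * (HV (suc r) + (y - a r) * HV r))
              ≈⟨ *-congˡ (*-congˡ (sym (H-linear x (l′ ∷ ls) .comb _ _ _))) ⟩
            ⟦ l′ <ᵇ suc r ⟧ * ((x + z) * HV′ r) ∎
            where
            first : coeff (suc r) (suc r) * ((x + z) * HV (suc r)) ≈ (x + z) * HV (suc r)
            first = trans (*-congʳ (*-cong (reflexive (≡.cong ⟦_⟧ (<ᵇ-true (ℕₚ.m≤n⇒m≤1+n (ℕₚ.≤-refl {suc (suc r)}))))) (interval-empty r _)))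
                          (trans (*-congʳ (*-identityˡ _)) (*-identityˡ _))
            second : T (l′ <ᵇ suc r) → coeff (suc r) r * ((x + z) * HV r) ≈ (x + z) * ((y - a r) * HV r)
            second l′≤r = trans (*-congʳ (trans (*-cong (reflexive (≡.cong ⟦_⟧ (<ᵇ-true (ℕₚ.≤-refl {suc (suc r)}))))
                (trans (interval-last {r} {r} _ ℕₚ.≤-refl) (trans (*-cong (interval-empty r _) (diagonal-free r l′≤r)) (*-identityˡ _)))) (*-identityˡ _)))
              (solve 3 (λ b c h → b :* (c :* h) := c :* (b :* h)) refl _ (x + z) _)
            others : ∑ (downFrom r) (λ κ → coeff (suc r) κ * ((x + z) * HV κ)) ≈ 0#
            others = trans (∑<-cong r λ κ κ<r → trans (*-congʳ (trans (*-congʳ (reflexive (≡.cong ⟦_⟧ (<ᵇ-false κ<r)))) (zeroˡ _))) (zeroˡ _))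
                           (∑-0 (downFrom r))

      K-suc : ∀ m (ν : Vec ℕ n) → K (suc m ℕ.* 2) ν ≈
              Strips.B true true (wʰ (x m) (y m) (z m)) 0 (const true) ν
                (λ ρ → Strips.B false true (wᵛ (x m) (y m) (z m)) 0 (const true) ρ (K (m ℕ.* 2)))
      K-suc m ν = trans
        (branch-top (suc (m ℕ.* 2)) 0 (const true) (const true) (const true) (byRank-odd _ _ m)
          (λ { i zero → reflexive (byRank-odd _ _ m) ; i (suc j) → reflexive (byRank-odd _ _ m) })
          (λ _ _ _ → ≡.refl) ν)
        (Strips.B-linear true true _ 0 (const true) ν .cong λ ρ →
          branch-top (m ℕ.* 2) 0 (const true) (const true) (const true) (byRank-even _ _ m)
            (λ { i zero → reflexive (byRank-even _ _ m) ; i (suc j) → reflexive (byRank-even _ _ m) })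
            (λ _ _ _ → ≡.refl) ρ)

      K-vanish : ∀ m {i} {ν : Vec ℕ n} → m ℕ.≤ i → Part 1 i ν → K (m ℕ.* 2) ν ≈ 0#
      K-vanish zero            m≤i         p = S-empty W {i = 0} p
      K-vanish (suc m) {suc i} {ν} (ℕ.s≤s m≤i) p = trans (K-suc m ν) (trans
        (Strips.B-cong true true _ 0 _ ν {g′ = const 0#} λ ρ st → trans
          (Strips.B-cong false true _ 0 _ ρ {g′ = const 0#} λ κ st′ →
            -- A row above a nonempty one keeps at least two boxes when the letters n go, because
            -- the shifted shape is strict there, and still one when an n′ goes.
            K-vanish m m≤i (strip-part′ st′ (strip-part {t′ = 2} (λ { {suc l} {q} 1≤l l<q → ℕₚ.≤-trans (ℕ.s≤s 1≤l) (ℕₚ.<ᵇ⇒< (suc l) q l<q) }) st p)))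
          (zeros (Strips.B-linear false true _ 0 _ ρ)))
        (zeros (Strips.B-linear true true _ 0 _ ν)))

      factor : ℕ → Carrier
      factor m = ∏[ 0 , m ⟩ (λ j → (x j + z j) * ∏[ 0 , j ⟩ (λ i → x i + y j))

      -- Stated for all positive vectors because the induction hypothesis is applied under `V`,
      -- whose arguments need not be strict.
      K≈Z : ∀ m (ν : Vec ℕ m) → All (0 ℕ.<_) ν → K (m ℕ.* 2) ν ≈ factor m * Z x ν
      K≈Z zero    []      _   = sym (*-identityˡ _)
      K≈Z (suc m) (l ∷ ν) pos = begin
        K (suc m ℕ.* 2) (l ∷ ν)
          ≈⟨ K-suc m (l ∷ ν) ⟩
        _ ≈⟨ strips-HV (x m) (y m) (z m) 0 (const true) (const true) l ν pos (λ _ _ _ → tt) (K (m ℕ.* 2)) (K (m ℕ.* 2))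
               (λ κ → K-vanish m ℕₚ.≤-refl) (S-∷ʳ0 W (m ℕ.* 2) 0 (const true) ≡.refl) ⟩
        1# * ((x m + z m) * H (x m) (l ∷ ν) (λ κ → V (y m) κ (K (m ℕ.* 2))))
          ≈⟨ trans (*-identityˡ _) (*-congˡ (H-cong (x m) (l ∷ ν) λ κ il → begin
               V (y m) κ (K (m ℕ.* 2))              ≈⟨ V-cong (y m) κ (strict⇒positive (interlace-strict pos il)) (K≈Z m) ⟩
               V (y m) κ (λ κ → factor m * Z x κ)   ≈⟨ scale (V-linear (y m) κ) _ _ ⟩
               factor m * V (y m) κ (Z x)           ≈⟨ *-congˡ (V-Z (y m) x (interlace-strict pos il)) ⟩
               factor m * (∏[ 0 , m ⟩ (λ i → x i + y m) * Z x κ)  ≈⟨ sym (*-assoc _ _ _) ⟩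
               (factor m * ∏[ 0 , m ⟩ (λ i → x i + y m)) * Z x κ  ∎)) ⟩
        (x m + z m) * H (x m) (l ∷ ν) (λ κ → (factor m * ∏[ 0 , m ⟩ (λ i → x i + y m)) * Z x κ)
          ≈⟨ *-congˡ (scale (H-linear (x m) (l ∷ ν)) _ _) ⟩
        (x m + z m) * ((factor m * ∏[ 0 , m ⟩ (λ i → x i + y m)) * Z x (l ∷ ν))
          ≈⟨ solve 4 (λ c f p h → c :* ((f :* p) :* h) := (f :* (c :* p)) :* h) refl (x m + z m) _ _ _ ⟩
        (factor m * ((x m + z m) * ∏[ 0 , m ⟩ (λ i → x i + y m))) * Z x (l ∷ ν)
          ≈⟨ *-congʳ (sym (interval-last {0} {m} _ ℕ.z≤n)) ⟩
        factor (suc m) * Z x (l ∷ ν) ∎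

-- Global tableau conditions versus the row-by-row test.

before⇒ : ∀ h a b → T (before h a b) → a ℕ.< b ⊎ (a ≡ b × T (h a))
before⇒ h a b a≼b with to T-∨ a≼b
... | inj₁ a<b = inj₁ (ℕₚ.<ᵇ⇒< a b a<b)
... | inj₂ eq  with to (T-∧ {a ≡ᵇ b}) eq
...   | a≡b , ha = inj₂ (ℕₚ.≡ᵇ⇒≡ a b a≡b , ha)

⇒before : ∀ h {a b} → a ℕ.< b ⊎ (a ≡ b × T (h a)) → T (before h a b)
⇒before h {a} {b} (inj₁ a<b)           = from (T-∨ {a <ᵇ b}) (inj₁ (ℕₚ.<⇒<ᵇ a<b))
⇒before h {a} {b} (inj₂ (≡.refl , ha)) = from (T-∨ {a <ᵇ a}) (inj₂ (from T-∧ (ℕₚ.≡⇒≡ᵇ a a ≡.refl , ha)))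

before-trans : ∀ h {a b c} → T (before h a b) → T (before h b c) → T (before h a c)
before-trans h {a} {b} {c} a≼b b≼c with before⇒ h a b a≼b | before⇒ h b c b≼c
... | inj₁ a<b           | inj₁ b<c           = ⇒before h (inj₁ (ℕₚ.<-trans a<b b<c))
... | inj₁ a<b           | inj₂ (≡.refl , _)  = ⇒before h (inj₁ a<b)
... | inj₂ (≡.refl , _)  | _                  = b≼c

mapᶠ : (L → ℕ) → Filling L ν → Filling ℕ ν
mapᶠ f = All.map (Vec.map f)

entry-map : ∀ (f : L → ℕ) (t : Filling L ν) i j → entry (mapᶠ f t) i j ≡ f (entry t i j)
entry-map f (v ∷ t) zero    j = lookup-map j f v
entry-map f (v ∷ t) (suc i) j = entry-map f t i j

column : Bool → ℕ → ℕ → ℕ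
column false i j = j
column true  i j = i ℕ.+ j

column-suc : ∀ s i i′ {j j′} → column s (suc i) j ≡ column s (suc i′) j′ → column s i j ≡ column s i′ j′
column-suc false i i′ eq = eq
column-suc true  i i′ eq = ℕₚ.suc-injective eq

column-zero : ∀ s {j c} → column s 0 j ≡ c → j ≡ c
column-zero false eq = eq
column-zero true  eq = eq

module Validity (h : ℕ → Bool) (s : Bool) where

  open Shape h

  valid : (∀ {l} → Vec ℕ l → Bool) → Filling ℕ ν → Bool
  valid φ []      = true
  valid φ (v ∷ t) = row v ∧ (φ v ∧ valid (col s v) t)

  Rows : Filling ℕ ν → Set
  Rows t = ∀ i j j′ → j Fin.< j′ → T (before h (entry t i j) (entry t i j′))

  Columns : Filling ℕ ν → Set
  Columns t = ∀ i i′ j j′ → i Fin.< i′ → column s (toℕ i) (toℕ j) ≡ column s (toℕ i′) (toℕ j′) →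
              T (before (not ∘ h) (entry t i j) (entry t i′ j′))

  row⇒ : (v : Vec ℕ l) → T (row v) → ∀ j j′ → j Fin.< j′ → T (before h (lookup v j) (lookup v j′))
  row⇒ (a ∷ v)     ok (suc j) (suc j′)       j<j′ = row⇒ v (proj₂ (to (T-∧ {headOK a v}) ok)) j j′ (ℕₚ.≤-pred j<j′)
  row⇒ (a ∷ b ∷ v) ok zero    (suc zero)     _    = proj₁ (to T-∧ ok)
  row⇒ (a ∷ b ∷ v) ok zero    (suc (suc j′)) _    =
    before-trans h {a} {b} (proj₁ (to (T-∧ {before h a b}) ok))
      (row⇒ (b ∷ v) (proj₂ (to (T-∧ {before h a b}) ok)) zero (suc j′) (ℕ.s≤s ℕ.z≤n))

  ⇒row : (v : Vec ℕ l) → (∀ j j′ → j Fin.< j′ → T (before h (lookup v j) (lookup v j′))) → T (row v)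
  ⇒row []          f = tt
  ⇒row (a ∷ [])    f = tt
  ⇒row (a ∷ b ∷ v) f = from T-∧ (f zero (suc zero) (ℕ.s≤s ℕ.z≤n) , ⇒row (b ∷ v) λ j j′ j<j′ → f (suc j) (suc j′) (ℕ.s≤s j<j′))

  above⇒ : (u : Vec ℕ k) (v : Vec ℕ l) → T (above u v) → ∀ j′ →
           Σ[ j ∈ Fin k ] toℕ j ≡ toℕ j′ × T (before (not ∘ h) (lookup u j) (lookup v j′))
  above⇒ (a ∷ u) (b ∷ v) ok zero     = zero , ≡.refl , proj₁ (to T-∧ ok)
  above⇒ (a ∷ u) (b ∷ v) ok (suc j′) with above⇒ u v (proj₂ (to (T-∧ {before (not ∘ h) a b}) ok)) j′
  ... | j , eq , a≼b = suc j , ≡.cong suc eq , a≼b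

  ⇒above : (u : Vec ℕ k) (v : Vec ℕ l) → l ℕ.≤ k →
           (∀ j j′ → toℕ j ≡ toℕ j′ → T (before (not ∘ h) (lookup u j) (lookup v j′))) → T (above u v)
  ⇒above u       []      _           f = tt
  ⇒above (a ∷ u) (b ∷ v) (ℕ.s≤s l≤k) f =
    from T-∧ (f zero zero ≡.refl , ⇒above u v l≤k λ j j′ eq → f (suc j) (suc j′) (≡.cong suc eq))

  col⇒ : ∀ s (u : Vec ℕ k) (v : Vec ℕ l) → T (col s u v) → ∀ j′ →
         Σ[ j ∈ Fin k ] toℕ j ≡ column s 1 (toℕ j′) × T (before (not ∘ h) (lookup u j) (lookup v j′))
  col⇒ false u       v       ok j′ = above⇒ u v ok j′
  col⇒ true  (a ∷ u) (b ∷ v) ok j′ with above⇒ u (b ∷ v) ok j′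
  ... | j , eq , a≼b = suc j , ≡.cong suc eq , a≼b

  ⇒col : ∀ s (u : Vec ℕ k) (v : Vec ℕ l) → T (lt s l k) →
         (∀ j j′ → toℕ j ≡ column s 1 (toℕ j′) → T (before (not ∘ h) (lookup u j) (lookup v j′))) → T (col s u v)
  ⇒col {k = k} {l} false u v ok f = ⇒above u v (ℕₚ.≤-pred (ℕₚ.<ᵇ⇒< l (suc k) ok)) f
  ⇒col true  u       []      ok f = tt
  ⇒col true  (a ∷ u) (b ∷ v) ok f =
    ⇒above u (b ∷ v) (ℕₚ.<ᵇ⇒< _ _ ok) λ j j′ eq → f (suc j) j′ (≡.cong suc eq)

  column-below : ∀ s {i j₁ j c} → j ≡ column s 1 j₁ → j₁ ≡ column s (suc i) c → j ≡ column s (suc (suc i)) c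
  column-below false ≡.refl eq     = eq
  column-below true  ≡.refl ≡.refl = ≡.refl

  -- Adjacent rows are chained by transitivity. Each link also supplies the box overhead, so the
  -- column reaches up to `u` without any assumption on the shape.
  valid-below : (u : Vec ℕ k) (t : Filling ℕ ν) → T (valid (col s u) t) → ∀ i′ j′ →
                Σ[ j ∈ Fin k ] toℕ j ≡ column s (suc (toℕ i′)) (toℕ j′) × T (before (not ∘ h) (lookup u j) (entry t i′ j′))
  valid-below u (v ∷ t) ok i′       j′ with to (T-∧ {col s u v}) (proj₂ (to (T-∧ {row v}) ok))
  valid-below u (v ∷ t) ok zero     j′ | okc , _   = col⇒ s u v okc j′
  valid-below u (v ∷ t) ok (suc i′) j′ | okc , ok′ with valid-below v t ok′ i′ j′
  ... | j₁ , eq₁ , b₁ with col⇒ s u v okc j₁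
  ...   | j , eq , b = j , column-below s eq eq₁ , before-trans (not ∘ h) {lookup u j} {lookup v j₁} b b₁

  valid⇒ : ∀ (φ : ∀ {l} → Vec ℕ l → Bool) (t : Filling ℕ ν) → T (valid φ t) → Rows t × Columns t
  valid⇒ φ []      _  = (λ ()) , (λ ())
  valid⇒ φ (v ∷ t) ok with to (T-∧ {row v}) ok
  ... | okr , okφ with to (T-∧ {φ v}) okφ
  ...   | _ , ok′ with valid⇒ (col s v) t ok′
  ...     | rows , cols = rows′ , cols′
    where
    rows′ : Rows (v ∷ t)
    rows′ zero    j j′ j<j′ = row⇒ v okr j j′ j<j′
    rows′ (suc i) j j′ j<j′ = rows i j j′ j<j′
    cols′ : Columns (v ∷ t)
    cols′ (suc i) (suc i′) j j′ i<i′ eq = cols i i′ j j′ (ℕₚ.≤-pred i<i′) (column-suc s (toℕ i) (toℕ i′) eq)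
    cols′ zero    (suc i′) j j′ _    eq with valid-below v t ok′ i′ j′
    ... | j₀ , eq₀ , b = ≡.subst (λ j → T (before (not ∘ h) (lookup v j) (entry t i′ j′)))
                          (Finₚ.toℕ-injective (≡.trans eq₀ (≡.sym (column-zero s eq)))) b

  FirstRow : (∀ {l} → Vec ℕ l → Bool) → Filling ℕ ν → Set
  FirstRow φ []      = ⊤
  FirstRow φ (v ∷ t) = T (φ v)

  unconstrained : (t : Filling ℕ ν) → FirstRow (const true) t
  unconstrained []      = tt
  unconstrained (v ∷ t) = tt

  column-from-zero : ∀ s {j c} → j ≡ column s 1 c → column s 0 j ≡ column s 1 c
  column-from-zero false eq = eq
  column-from-zero true  eq = eq

  column-to-suc : ∀ s i i′ {j j′} → column s i j ≡ column s i′ j′ → column s (suc i) j ≡ column s (suc i′) j′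
  column-to-suc false i i′ eq = eq
  column-to-suc true  i i′ eq = ≡.cong suc eq

  -- Conditions on entries say nothing about boxes with no box above them, so the comparison of row
  -- lengths has to come from the shape.
  ⇒valid : ∀ (φ : ∀ {l} → Vec ℕ l → Bool) (t : Filling ℕ ν) → Linked (λ k l → T (lt s l k)) ν → FirstRow φ t →
           Rows t → Columns t → T (valid φ t)
  ⇒valid φ []      shape first rows cols = tt
  ⇒valid φ (v ∷ t) shape first rows cols = from T-∧ (⇒row v (rows zero) , from T-∧ (first ,
    ⇒valid (col s v) t (tail shape) (next t shape cols) (rows ∘ suc)
      λ i i′ j j′ i<i′ eq → cols (suc i) (suc i′) j j′ (ℕ.s≤s i<i′) (column-to-suc s (toℕ i) (toℕ i′) eq)))
    where
    tail : ∀ {k n} {ν : Vec ℕ n} → Linked (λ k l → T (lt s l k)) (k ∷ ν) → Linked (λ k l → T (lt s l k)) ν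
    tail [-]       = []
    tail (_ ∷ pxs) = pxs
    next : ∀ {n} {ν : Vec ℕ n} (t : Filling ℕ ν) → Linked (λ k l → T (lt s l k)) (_ ∷ ν) → Columns (v ∷ t) → FirstRow (col s v) t
    next []       _        cols = tt
    next (v′ ∷ t) (lk ∷ _) cols = ⇒col s v v′ lk λ j j′ eq →
      cols zero (suc zero) j j′ (ℕ.s≤s ℕ.z≤n) (column-from-zero s eq)

does-≡ : ∀ {P : Set} (P? : Dec P) b → (P → T b) → (T b → P) → does P? ≡ b
does-≡ P? true  f g = dec-true P? (g tt)
does-≡ P? false f g = dec-false P? f

module _ (t : Filling (Fin m) ν) where

  open Validity (const true) false

  semistandard⇒ : IsSemistandard t → Rows (mapᶠ toℕ t) × Columns (mapᶠ toℕ t)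
  semistandard⇒ (rows , cols) = rows′ , cols′
    where
    rows′ : Rows (mapᶠ toℕ t)
    rows′ i j j′ j<j′ rewrite entry-map toℕ t i j | entry-map toℕ t i j′ with ℕₚ.m≤n⇒m<n∨m≡n (rows i j j′ (ℕₚ.<⇒≤ j<j′))
    ... | inj₁ a<b = ⇒before (const true) (inj₁ a<b)
    ... | inj₂ a≡b = ⇒before (const true) (inj₂ (a≡b , tt))
    cols′ : Columns (mapᶠ toℕ t)
    cols′ i i′ j j′ i<i′ eq rewrite entry-map toℕ t i j | entry-map toℕ t i′ j′ =
      ⇒before (const false) (inj₁ (cols i i′ j j′ i<i′ eq))

  ⇒semistandard : Rows (mapᶠ toℕ t) → Columns (mapᶠ toℕ t) → IsSemistandard t
  ⇒semistandard rows cols = rows′ , cols′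
    where
    rows′ : RowsWeaklyIncrease t
    rows′ i j j′ j≤j′ with ℕₚ.m≤n⇒m<n∨m≡n j≤j′
    ... | inj₂ j≡j′ rewrite Finₚ.toℕ-injective j≡j′ = ℕₚ.≤-refl
    ... | inj₁ j<j′ with rows i j j′ j<j′
    ...   | b rewrite entry-map toℕ t i j | entry-map toℕ t i j′ with before⇒ (const true) (toℕ (entry t i j)) (toℕ (entry t i j′)) b
    ...     | inj₁ a<b       = ℕₚ.<⇒≤ a<b
    ...     | inj₂ (a≡b , _) = ℕₚ.≤-reflexive a≡b
    cols′ : ColumnsStrictlyIncrease t
    cols′ i i′ j j′ i<i′ eq with cols i i′ j j′ i<i′ eq
    ... | b rewrite entry-map toℕ t i j | entry-map toℕ t i′ j′ with before⇒ (const false) (toℕ (entry t i j)) (toℕ (entry t i′ j′)) b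
    ...   | inj₁ a<b = a<b

  isSemistandard-valid : IsPartition ν → does (isSemistandard? t) ≡ valid (const true) (mapᶠ toℕ t)
  isSemistandard-valid partition = does-≡ (isSemistandard? t) _
    (λ ss → let rows , cols = semistandard⇒ ss in
      ⇒valid (const true) (mapᶠ toℕ t) (Linked.map (λ l≤k → ℕₚ.<⇒<ᵇ (ℕ.s≤s l≤k)) partition) (unconstrained (mapᶠ toℕ t)) rows cols)
    (λ ok → let rows , cols = valid⇒ (const true) (mapᶠ toℕ t) ok in ⇒semistandard rows cols)

rank-primed : (k : Fin m) → rank (primed k) ≡ toℕ k ℕ.* 2
rank-primed k = ℕₚ.*-comm 2 (toℕ k)

rank-unprimed : (k : Fin m) → rank (unprimed k) ≡ suc (toℕ k ℕ.* 2)
rank-unprimed k = ≡.cong suc (ℕₚ.*-comm 2 (toℕ k))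

isOdd-primed : (k : Fin m) → isOdd (rank (primed k)) ≡ false
isOdd-primed k rewrite rank-primed k = byRank-even _ _ (toℕ k)

isOdd-unprimed : (k : Fin m) → isOdd (rank (unprimed k)) ≡ true
isOdd-unprimed k rewrite rank-unprimed k = byRank-odd _ _ (toℕ k)

rank-injective : (a b : Letter m) → rank a ≡ rank b → a ≡ b
rank-injective (primed k)   (primed l)   eq = ≡.cong primed (Finₚ.toℕ-injective (ℕₚ.*-cancelˡ-≡ _ _ 2 eq))
rank-injective (unprimed k) (unprimed l) eq = ≡.cong unprimed (Finₚ.toℕ-injective (ℕₚ.*-cancelˡ-≡ _ _ 2 (ℕₚ.suc-injective eq)))
rank-injective (primed k)   (unprimed l) eq with ≡.trans (≡.sym (isOdd-primed k)) (≡.trans (≡.cong isOdd eq) (isOdd-unprimed l))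
... | ()
rank-injective (unprimed k) (primed l)   eq with ≡.trans (≡.sym (isOdd-primed l)) (≡.trans (≡.cong isOdd (≡.sym eq)) (isOdd-unprimed k))
... | ()

not-primed⇒odd : (a : Letter m) → (∀ k → a ≢ primed k) → T (isOdd (rank a))
not-primed⇒odd (primed k)   f = ⊥-elim (f k ≡.refl)
not-primed⇒odd (unprimed k) f rewrite isOdd-unprimed k = tt

not-unprimed⇒even : (a : Letter m) → (∀ k → a ≢ unprimed k) → T (not (isOdd (rank a)))
not-unprimed⇒even (unprimed k) f = ⊥-elim (f k ≡.refl)
not-unprimed⇒even (primed k)   f rewrite isOdd-primed k = tt

module _ (t : Filling (Letter m) ν) where

  open Validity isOdd true

  -- Two equal letters in a row cannot be primed, and two in a column cannot be unprimed; this is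
  -- the equality case of `before`.
  primedShifted⇒ : IsPrimedShifted t → Rows (mapᶠ rank t) × Columns (mapᶠ rank t)
  primedShifted⇒ (rows , cols , once , once′) = rows′ , cols′
    where
    rows′ : Rows (mapᶠ rank t)
    rows′ i j j′ j<j′ rewrite entry-map rank t i j | entry-map rank t i j′ with ℕₚ.m≤n⇒m<n∨m≡n (rows i j j′ (ℕₚ.<⇒≤ j<j′))
    ... | inj₁ a<b = ⇒before isOdd (inj₁ a<b)
    ... | inj₂ a≡b = ⇒before isOdd (inj₂ (a≡b , not-primed⇒odd (entry t i j) λ k a≡k →
      ℕₚ.<⇒≢ j<j′ (≡.cong toℕ (once k i j j′ a≡k (≡.trans (≡.sym (rank-injective _ _ a≡b)) a≡k)))))
    cols′ : Columns (mapᶠ rank t)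
    cols′ i i′ j j′ i<i′ eq rewrite entry-map rank t i j | entry-map rank t i′ j′ with ℕₚ.m≤n⇒m<n∨m≡n (cols i i′ j j′ (ℕₚ.<⇒≤ i<i′) eq)
    ... | inj₁ a<b = ⇒before (not ∘ isOdd) (inj₁ a<b)
    ... | inj₂ a≡b = ⇒before (not ∘ isOdd) (inj₂ (a≡b , not-unprimed⇒even (entry t i j) λ k a≡k →
      ℕₚ.<⇒≢ i<i′ (≡.cong toℕ (once′ k i i′ j j′ eq a≡k (≡.trans (≡.sym (rank-injective _ _ a≡b)) a≡k)))))

  ⇒primedShifted : Rows (mapᶠ rank t) → Columns (mapᶠ rank t) → IsPrimedShifted t
  ⇒primedShifted rows cols = rows′ , cols′ , once , once′
    where
    weak : ∀ h a b → T (before h a b) → a ℕ.≤ b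
    weak h a b p with before⇒ h a b p
    ... | inj₁ a<b       = ℕₚ.<⇒≤ a<b
    ... | inj₂ (a≡b , _) = ℕₚ.≤-reflexive a≡b

    strict : ∀ h a → h a ≡ false → ¬ T (before h a a)
    strict h a ha b = ≡.subst T (≡.trans (before-≡ h a) ha) b

    rowᵗ : ∀ i j j′ → j Fin.< j′ → T (before isOdd (rank (entry t i j)) (rank (entry t i j′)))
    rowᵗ i j j′ j<j′ = ≡.subst₂ (λ a b → T (before isOdd a b)) (entry-map rank t i j) (entry-map rank t i j′) (rows i j j′ j<j′)

    colᵗ : ∀ i i′ j j′ → i Fin.< i′ → SameColumn t i i′ j j′ → T (before (not ∘ isOdd) (rank (entry t i j)) (rank (entry t i′ j′)))
    colᵗ i i′ j j′ i<i′ eq = ≡.subst₂ (λ a b → T (before (not ∘ isOdd) a b)) (entry-map rank t i j) (entry-map rank t i′ j′) (cols i i′ j j′ i<i′ eq)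

    rows′ : ShiftedRowsWeaklyIncrease t
    rows′ i j j′ j≤j′ with ℕₚ.m≤n⇒m<n∨m≡n j≤j′
    ... | inj₂ j≡j′ rewrite Finₚ.toℕ-injective j≡j′ = ℕₚ.≤-refl
    ... | inj₁ j<j′ = weak isOdd _ _ (rowᵗ i j j′ j<j′)

    cols′ : ShiftedColumnsWeaklyIncrease t
    cols′ i i′ j j′ i≤i′ eq with ℕₚ.m≤n⇒m<n∨m≡n i≤i′
    ... | inj₁ i<i′ = weak (not ∘ isOdd) _ _ (colᵗ i i′ j j′ i<i′ eq)
    ... | inj₂ i≡i′ with Finₚ.toℕ-injective i≡i′
    ...   | ≡.refl rewrite Finₚ.toℕ-injective (ℕₚ.+-cancelˡ-≡ (toℕ i) _ _ eq) = ℕₚ.≤-refl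

    once : AtMostOnePrimedPerRow t
    once k i j j′ a≡k b≡k with Finₚ.<-cmp j j′
    ... | tri≈ _ j≡j′ _ = j≡j′
    ... | tri< j<j′ _ _ = ⊥-elim (strict isOdd (rank (primed k)) (isOdd-primed k)
      (≡.subst₂ (λ a b → T (before isOdd (rank a) (rank b))) a≡k b≡k (rowᵗ i j j′ j<j′)))
    ... | tri> _ _ j>j′ = ⊥-elim (strict isOdd (rank (primed k)) (isOdd-primed k)
      (≡.subst₂ (λ a b → T (before isOdd (rank a) (rank b))) b≡k a≡k (rowᵗ i j′ j j>j′)))

    once′ : AtMostOneUnprimedPerColumn t
    once′ k i i′ j j′ eq a≡k b≡k with Finₚ.<-cmp i i′
    ... | tri≈ _ i≡i′ _ = i≡i′
    ... | tri< i<i′ _ _ = ⊥-elim (strict (not ∘ isOdd) (rank (unprimed k)) (≡.cong not (isOdd-unprimed k))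
      (≡.subst₂ (λ a b → T (before (not ∘ isOdd) (rank a) (rank b))) a≡k b≡k (colᵗ i i′ j j′ i<i′ eq)))
    ... | tri> _ _ i>i′ = ⊥-elim (strict (not ∘ isOdd) (rank (unprimed k)) (≡.cong not (isOdd-unprimed k))
      (≡.subst₂ (λ a b → T (before (not ∘ isOdd) (rank a) (rank b))) b≡k a≡k (colᵗ i′ i j′ j i>i′ (≡.sym eq))))

  isPrimedShifted-valid : Linked ℕ._>_ ν → does (isPrimedShifted? t) ≡ valid (const true) (mapᶠ rank t)
  isPrimedShifted-valid strict = does-≡ (isPrimedShifted? t) _
    (λ ps → let rows , cols = primedShifted⇒ ps in
      ⇒valid (const true) (mapᶠ rank t) (Linked.map >⇒lt strict) (unconstrained (mapᶠ rank t)) rows cols)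
    (λ ok → let rows , cols = valid⇒ (const true) (mapᶠ rank t) ok in ⇒primedShifted rows cols)
    where
    >⇒lt : ∀ {k l} → k ℕ.> l → T (lt true l k)
    >⇒lt {k} {zero}  l<k = tt
    >⇒lt {k} {suc l} l<k = ℕₚ.<⇒<ᵇ l<k

diagonalOdd : Filling ℕ ν → Bool
diagonalOdd []            = true
diagonalOdd ([]      ∷ t) = diagonalOdd t
diagonalOdd ((a ∷ v) ∷ t) = isOdd a ∧ diagonalOdd t

unprimedDiagonal⇒ : (t : Filling (Letter m) ν) → UnprimedDiagonal t → T (diagonalOdd (mapᶠ rank t))
unprimedDiagonal⇒ []            ud = tt
unprimedDiagonal⇒ ([]      ∷ t) ud = unprimedDiagonal⇒ t λ k i → ud k (suc i)
unprimedDiagonal⇒ ((a ∷ v) ∷ t) ud =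
  from T-∧ (not-primed⇒odd a (λ k → ud k zero zero ≡.refl) , unprimedDiagonal⇒ t λ k i → ud k (suc i))

⇒unprimedDiagonal : (t : Filling (Letter m) ν) → T (diagonalOdd (mapᶠ rank t)) → UnprimedDiagonal t
⇒unprimedDiagonal ([]      ∷ t) ok k (suc i) = ⇒unprimedDiagonal t ok k i
⇒unprimedDiagonal ((a ∷ v) ∷ t) ok k (suc i) = ⇒unprimedDiagonal t (proj₂ (to (T-∧ {isOdd (rank a)}) ok)) k i
⇒unprimedDiagonal ((a ∷ v) ∷ t) ok k zero zero _ ≡.refl =
  ≡.subst T (isOdd-primed k) (proj₁ (to (T-∧ {isOdd (rank a)}) ok))

-- From the lists of fillings to the generating functions, and the product formulas.

module Assembly {c ℓ} (R : CommutativeRing c ℓ) where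

  open CommutativeRing R hiding (zero)
  open FactorialSchur R
  open Sums R
  open Branch R
  open Evaluate R
  open import Algebra.Properties.CommutativeMonoid.Sum *-commutativeMonoid
    using () renaming (sum-cong-≋ to ∏-cong; sum-replicate-zero to ∏-1; ∑-distrib-+ to ∏-distrib-*; ∑-comm to ∏-comm)
  open import Algebra.Solver.Ring.NaturalCoefficients.Default commutativeSemiring
    using (solve; _:=_; _:+_; _:*_)
  open import Relation.Binary.Reasoning.Setoid setoid

  -- The removal argument names letters by natural numbers; 0# is a default beyond the alphabet.
  extend : (Fin n → Carrier) → ℕ → Carrier
  extend {zero}  x k       = 0#
  extend {suc n} x zero    = x zero
  extend {suc n} x (suc k) = extend (x ∘ suc) k

  extend-toℕ : (x : Fin n → Carrier) (i : Fin n) → extend x (toℕ i) ≡ x i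
  extend-toℕ x zero    = ≡.refl
  extend-toℕ x (suc i) = extend-toℕ (x ∘ suc) i

  -- `tabulate` runs upwards and `downFrom` downwards; splitting off index 0 from the latter
  -- reconciles them.
  ∑-tabulate : ∀ (f : Fin n → L) (g : L → Carrier) (g′ : ℕ → Carrier) → (∀ i → g (f i) ≈ g′ (toℕ i)) →
               ∑ (tabulate f) g ≈ ∑ (downFrom n) g′
  ∑-tabulate {n = zero}  f g g′ eq = refl
  ∑-tabulate {n = suc n} f g g′ eq =
    trans (+-cong (eq zero) (∑-tabulate (f ∘ suc) g (g′ ∘ suc) (eq ∘ suc))) (sym (∑<-suc n g′))

  ∑-allFin : ∀ n (g : ℕ → Carrier) → ∑ (allFin n) (g ∘ toℕ) ≈ ∑ (downFrom n) g
  ∑-allFin n g = ∑-tabulate {n = n} id (g ∘ toℕ) g λ _ → refl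

  ∑-letters : ∀ n (g : ℕ → Carrier) → ∑ (letters n) (g ∘ rank) ≈ ∑ (downFrom (n ℕ.* 2)) g
  ∑-letters n g = begin
    ∑ (letters n) (g ∘ rank)
      ≈⟨ trans (∑-++ (map primed (allFin n))) (+-cong (∑-map primed (allFin n)) (∑-map unprimed (allFin n))) ⟩
    ∑ (allFin n) (λ k → g (rank (primed k))) + ∑ (allFin n) (λ k → g (rank (unprimed k)))
      ≈⟨ +-cong (∑-tabulate {n = n} id _ (λ k → g (k ℕ.* 2)) λ k → reflexive (≡.cong g (rank-primed k)))
                (∑-tabulate {n = n} id _ (λ k → g (suc (k ℕ.* 2))) λ k → reflexive (≡.cong g (rank-unprimed k))) ⟩
    ∑ (downFrom n) (λ k → g (k ℕ.* 2)) + ∑ (downFrom n) (λ k → g (suc (k ℕ.* 2)))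
      ≈⟨ interleave n ⟩
    ∑ (downFrom (n ℕ.* 2)) g ∎
    where
    interleave : ∀ n → ∑ (downFrom n) (λ k → g (k ℕ.* 2)) + ∑ (downFrom n) (λ k → g (suc (k ℕ.* 2))) ≈ ∑ (downFrom (n ℕ.* 2)) g
    interleave zero    = +-identityˡ _
    interleave (suc n) = trans
      (solve 4 (λ a s b t → (a :+ s) :+ (b :+ t) := b :+ (a :+ (s :+ t))) refl _ _ _ _)
      (+-congˡ (+-congˡ (interleave n)))

  module _ (f : L → ℕ) {as : List L} {bs : List ℕ} (eq : ∀ g → ∑ as (g ∘ f) ≈ ∑ bs g) where

    -- The hypothesis `eq` expresses through sums alone that `f` relabels the alphabet, so the order
    -- of the two lists is immaterial.
    ∑-words-map : ∀ k (g : Vec ℕ k → Carrier) → ∑ (words as k) (g ∘ Vec.map f) ≈ ∑ (words bs k) g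
    ∑-words-map zero    g = refl
    ∑-words-map (suc k) g = begin
      ∑ (words as (suc k)) (g ∘ Vec.map f)
        ≈⟨ ∑-words-suc as k _ ⟩
      ∑ as (λ a → ∑ (words as k) (λ v → g (f a ∷ Vec.map f v)))
        ≈⟨ ∑-cong as (λ a → ∑-words-map k (g ∘ (f a ∷_))) ⟩
      ∑ as (λ a → ∑ (words bs k) (λ v → g (f a ∷ v)))
        ≈⟨ eq (λ b → ∑ (words bs k) (λ v → g (b ∷ v))) ⟩
      ∑ bs (λ b → ∑ (words bs k) (λ v → g (b ∷ v)))
        ≈⟨ sym (∑-words-suc bs k g) ⟩
      ∑ (words bs (suc k)) g ∎

    ∑-fillings-map : ∀ (ν : Vec ℕ n) (g : Filling ℕ ν → Carrier) →
                     ∑ (fillings as ν) (g ∘ mapᶠ f) ≈ ∑ (fillings bs ν) g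
    ∑-fillings-map []      g = refl
    ∑-fillings-map (k ∷ ν) g = begin
      ∑ (fillings as (k ∷ ν)) (g ∘ mapᶠ f)
        ≈⟨ ∑-cartesian _∷_ (words as k) {fillings as ν} {g ∘ mapᶠ f} ⟩
      ∑ (words as k) (λ v → ∑ (fillings as ν) (λ t → g (Vec.map f v ∷ mapᶠ f t)))
        ≈⟨ ∑-cong (words as k) (λ v → ∑-fillings-map ν (g ∘ (Vec.map f v ∷_))) ⟩
      ∑ (words as k) (λ v → ∑ (fillings bs ν) (λ t → g (Vec.map f v ∷ t)))
        ≈⟨ ∑-words-map k (λ v → ∑ (fillings bs ν) (λ t → g (v ∷ t))) ⟩
      ∑ (words bs k) (λ v → ∑ (fillings bs ν) (λ t → g (v ∷ t)))
        ≈⟨ sym (∑-cartesian _∷_ (words bs k) {fillings bs ν} {g}) ⟩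
      ∑ (fillings bs (k ∷ ν)) g ∎

  wt : (ℕ → ℕ → ℕ → Carrier) → ℕ → Filling ℕ ν → Carrier
  wt W i []      = 1#
  wt W i (v ∷ t) = rowWt (W i) v * wt W (suc i) t

  rowWt-boxes : ∀ (f : L → ℕ) W (v : Vec L k) (w : Fin k → L → Carrier) → (∀ j c → w j c ≈ W (toℕ j) (f c)) →
                ∏ (λ j → w j (lookup v j)) ≈ rowWt W (Vec.map f v)
  rowWt-boxes f W []      w eq = refl
  rowWt-boxes f W (c ∷ v) w eq = *-cong (eq zero c) (rowWt-boxes f (W ∘ suc) v (w ∘ suc) (eq ∘ suc))

  wt-boxes : ∀ (f : L → ℕ) W i {ν : Vec ℕ m} (t : Filling L ν) (w : (i : Fin m) → Fin (lookup ν i) → L → Carrier) →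
             (∀ i′ j c → w i′ j c ≈ W (toℕ i′ ℕ.+ i) (toℕ j) (f c)) →
             ∏-boxes t w ≈ wt W i (mapᶠ f t)
  wt-boxes f W i []      w eq = refl
  wt-boxes f W i (v ∷ t) w eq = *-cong (rowWt-boxes f (W i) v (w zero) (eq zero))
    (wt-boxes f W (suc i) t (w ∘ suc) λ i′ j c → trans (eq (suc i′) j c)
      (reflexive (≡.cong (λ r → W r (toℕ j) (f c)) (≡.sym (ℕₚ.+-suc (toℕ i′) i)))))

  module _ (h : ℕ → Bool) (s : Bool) (W : ℕ → ℕ → ℕ → Carrier) where

    open Validity h s
    open Shape h
    open Tableaux h s

    S-fillings : ∀ m i (φ : ∀ {l} → Vec ℕ l → Bool) (ν : Vec ℕ n) →
                 ∑ (fillings (downFrom m) ν) (λ t → ⟦ valid φ t ⟧ * wt W i t) ≈ S W m i φ ν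
    S-fillings m i φ []      = trans (+-identityʳ _) (*-identityˡ _)
    S-fillings m i φ (l ∷ ν) = begin
      ∑ (fillings (downFrom m) (l ∷ ν)) (λ t → ⟦ valid φ t ⟧ * wt W i t)
        ≈⟨ ∑-cartesian _∷_ (words (downFrom m) l) {fillings (downFrom m) ν} {λ t → ⟦ valid φ t ⟧ * wt W i t} ⟩
      ∑ (words (downFrom m) l) (λ v → ∑ (fillings (downFrom m) ν) (λ t →
        ⟦ row v ∧ (φ v ∧ valid (col s v) t) ⟧ * (rowWt (W i) v * wt W (suc i) t)))
        ≈⟨ ∑-cong (words (downFrom m) l) (λ v → trans
             (∑-cong (fillings (downFrom m) ν) λ t → trans
               (*-congʳ (trans (⟦∧⟧ (row v) _) (*-congˡ (⟦∧⟧ (φ v) _))))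
               (solve 5 (λ r f b w t → (r :* (f :* b)) :* (w :* t) := (r :* (f :* w)) :* (b :* t)) refl _ _ _ _ _))
             (trans (Linear.scale (sum-linear (fillings (downFrom m) ν)) _ _)
             (trans (*-congˡ (S-fillings m (suc i) (col s v) ν))
                    (solve 4 (λ r f w t → (r :* (f :* w)) :* t := r :* (f :* (w :* t))) refl _ _ _ _)))) ⟩
      S W m i φ (l ∷ ν) ∎

  module _ (a : ℕ → Carrier) where

    open Operators a using (Z)

    schur≈Z : (μ : Vec ℕ n) → IsPartition μ → (x : Fin n → Carrier) → schur μ x a ≈ Z (extend x) (μ ⊕ δ n)
    schur≈Z {n} μ partition x = begin
      ∑ (𝒯 n μ) (wgtᵀ x a)
        ≈⟨ ∑-filter isSemistandard? (fillings (allFin n) μ) ⟩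
      ∑ (fillings (allFin n) μ) (λ t → ⟦ does (isSemistandard? t) ⟧ * wgtᵀ x a t)
        ≈⟨ ∑-cong (fillings (allFin n) μ) (λ t → *-cong
             (reflexive (≡.cong ⟦_⟧ (isSemistandard-valid t partition)))
             (wt-boxes toℕ W 0 t _ λ i j k → +-cong (reflexive (≡.sym (extend-toℕ x k)))
               (reflexive (≡.cong (λ i → a (toℕ k ℕ.+ suc (toℕ j) ℕ.∸ i)) (≡.sym (ℕₚ.+-identityʳ (toℕ i))))))) ⟩
      ∑ (fillings (allFin n) μ) (λ t → ⟦ valid (const true) (mapᶠ toℕ t) ⟧ * wt W 0 (mapᶠ toℕ t))
        ≈⟨ ∑-fillings-map toℕ (∑-allFin n) μ (λ t → ⟦ valid (const true) t ⟧ * wt W 0 t) ⟩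
      ∑ (fillings (downFrom n) μ) (λ t → ⟦ valid (const true) t ⟧ * wt W 0 t)
        ≈⟨ S-fillings (const true) false W n 0 (const true) μ ⟩
      G n μ
        ≈⟨ G≈Z n μ ⟩
      Z (extend x) (μ ⊕ δ n) ∎
      where
      open Validity (const true) false
      open Semistandard a (extend x)

    module _ (x y : Fin n → Carrier) where

      open Validity isOdd true

      private
        x′ = extend x
        y′ = extend y

      weight : (ℕ → Carrier) → Filling ℕ ν → Carrier
      weight z = wt (PrimedShifted.W a x′ y′ z) 0

      ∑-primedShifted : {ν : Vec ℕ n} → Linked ℕ._>_ ν → All (0 ℕ.<_) ν → (z : ℕ → Carrier) (g : Filling (Letter n) ν → Carrier) →
                        (∀ t → g t ≈ weight z (mapᶠ rank t)) →
                        ∑ (𝒬 n ν) g ≈ PrimedShifted.factor a x′ y′ z n * Z x′ ν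
      ∑-primedShifted {ν} strict positive z g g≈weight = begin
        ∑ (𝒬 n ν) g
          ≈⟨ ∑-filter isPrimedShifted? (fillings (letters n) ν) ⟩
        ∑ (fillings (letters n) ν) (λ t → ⟦ does (isPrimedShifted? t) ⟧ * g t)
          ≈⟨ ∑-cong (fillings (letters n) ν) (λ t → *-cong
               (reflexive (≡.cong ⟦_⟧ (isPrimedShifted-valid t strict))) (g≈weight t)) ⟩
        ∑ (fillings (letters n) ν) (λ t → ⟦ valid (const true) (mapᶠ rank t) ⟧ * weight z (mapᶠ rank t))
          ≈⟨ ∑-fillings-map rank (∑-letters n) ν (λ t → ⟦ valid (const true) t ⟧ * weight z t) ⟩
        ∑ (fillings (downFrom (n ℕ.* 2)) ν) (λ t → ⟦ valid (const true) t ⟧ * weight z t)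
          ≈⟨ S-fillings isOdd true W (n ℕ.* 2) 0 (const true) ν ⟩
        K (n ℕ.* 2) ν
          ≈⟨ K≈Z n ν positive ⟩
        factor n * Z x′ ν ∎
        where open PrimedShifted a x′ y′ z

      wgt≈weight : (t : Filling (Letter n) ν) → wgt x y a t ≈ weight y′ (mapᶠ rank t)
      wgt≈weight t = wt-boxes rank (PrimedShifted.W a x′ y′ y′) 0 t _ λ i j k → letter {toℕ i ℕ.+ 0} (toℕ j) k
        where
        letter : ∀ {i} d k → letterWgt x y a d k ≈ PrimedShifted.W a x′ y′ y′ i d (rank k)
        letter zero    (primed k)   rewrite rank-primed k =
          reflexive (≡.sym (≡.trans (byRank-even y′ x′ (toℕ k)) (extend-toℕ y k)))
        letter zero    (unprimed k) rewrite rank-unprimed k =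
          reflexive (≡.sym (≡.trans (byRank-odd y′ x′ (toℕ k)) (extend-toℕ x k)))
        letter (suc d) (primed k)   rewrite rank-primed k =
          reflexive (≡.sym (≡.trans (byRank-even _ _ (toℕ k)) (≡.cong (_- a (suc d)) (extend-toℕ y k))))
        letter (suc d) (unprimed k) rewrite rank-unprimed k =
          reflexive (≡.sym (≡.trans (byRank-odd _ _ (toℕ k)) (≡.cong (_+ a (suc d)) (extend-toℕ x k))))

      -- Restricting to unprimed diagonals amounts to giving primed diagonal
      -- entries the weight 0.

      unprimed-weight : (z : ℕ → Carrier) (t : Filling ℕ ν) → ⟦ diagonalOdd t ⟧ * weight z t ≈ weight (const 0#) t
      unprimed-weight z = go 0
        where
        Wᶻ = PrimedShifted.W a x′ y′ z
        W⁰ = PrimedShifted.W a x′ y′ (const 0#)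
        odd : ∀ (z x : ℕ → Carrier) r → ⟦ isOdd r ⟧ * byRank z x r ≈ byRank (const 0#) x r
        odd z x zero          = zeroˡ _
        odd z x (suc zero)    = *-identityˡ _
        odd z x (suc (suc r)) = odd (z ∘ suc) (x ∘ suc) r
        go : ∀ {n} {ν : Vec ℕ n} i (t : Filling ℕ ν) → ⟦ diagonalOdd t ⟧ * wt Wᶻ i t ≈ wt W⁰ i t
        go i []            = *-identityˡ _
        go i ([]      ∷ t) = trans (*-congˡ (*-identityˡ _)) (trans (go (suc i) t) (sym (*-identityˡ _)))
        go i ((r ∷ v) ∷ t) = trans (*-congʳ (⟦∧⟧ (isOdd r) _))
          (trans (solve 5 (λ b d w u t → (b :* d) :* ((w :* u) :* t) := ((b :* w) :* u) :* (d :* t)) refl _ _ _ _ _)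
                 (*-cong (*-congʳ (odd z x′ r)) (go (suc i) t)))

      schurQ≈ : {ν : Vec ℕ n} → Linked ℕ._>_ ν → All (0 ℕ.<_) ν →
                schurQ ν x y a ≈ PrimedShifted.factor a x′ y′ y′ n * Z x′ ν
      schurQ≈ strict positive = ∑-primedShifted strict positive y′ (wgt x y a) wgt≈weight

      schurP≈ : {ν : Vec ℕ n} → Linked ℕ._>_ ν → All (0 ℕ.<_) ν →
                schurP ν x y a ≈ PrimedShifted.factor a x′ y′ (const 0#) n * Z x′ ν
      schurP≈ {ν} strict positive = trans (∑-filter unprimedDiagonal? (𝒬 n ν))
        (∑-primedShifted strict positive (const 0#) _ λ t → trans
          (*-cong (reflexive (≡.cong ⟦_⟧ (does-≡ (unprimedDiagonal? t) _ (unprimedDiagonal⇒ t) (⇒unprimedDiagonal t))))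
                  (wgt≈weight t))
          (unprimed-weight y′ (mapᶠ rank t)))

  ∏-interval : ∀ n (f : ℕ → Carrier) → ∏[ 0 , n ⟩ f ≈ ∏ {n} (f ∘ toℕ)
  ∏-interval zero    f = refl
  ∏-interval (suc n) f = *-congˡ (∏-interval n (f ∘ suc))

  ∏-initial : ∀ {b} (f : ℕ → Carrier) → b ℕ.≤ n →
              ∏[ 0 , b ⟩ f ≈ ∏ {n} (λ i → if toℕ i <ᵇ b then f (toℕ i) else 1#)
  ∏-initial {n = n}     {b = zero} f _     = sym (∏-1 n)
  ∏-initial {n = suc n} f (ℕ.s≤s b≤n) = *-congˡ (∏-initial (f ∘ suc) b≤n)

  if-cong : ∀ b {b′} {u v : Carrier} → b ≡ b′ → u ≈ v → (if b then u else 1#) ≈ (if b′ then v else 1#)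
  if-cong true  ≡.refl eq = eq
  if-cong false ≡.refl eq = refl

  module _ (x y : Fin n → Carrier) where

    private
      x′ = extend x
      y′ = extend y

    factor-P : (a : ℕ → Carrier) → PrimedShifted.factor a x′ y′ (const 0#) n ≈ ∏ x * ∏-< (λ i j → x i + y j)
    factor-P a = begin
      ∏[ 0 , n ⟩ (λ j → (x′ j + 0#) * ∏[ 0 , j ⟩ (λ i → x′ i + y′ j))
        ≈⟨ ∏-interval n _ ⟩
      ∏ {n} (λ j → (x′ (toℕ j) + 0#) * ∏[ 0 , toℕ j ⟩ (λ i → x′ i + y′ (toℕ j)))
        ≈⟨ ∏-cong (λ j → *-cong (trans (+-identityʳ _) (reflexive (extend-toℕ x j)))
             (trans (∏-initial (λ i → x′ i + y′ (toℕ j)) (ℕₚ.<⇒≤ (Finₚ.toℕ<n j)))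
                    (∏-cong λ i → if-cong (toℕ i <ᵇ toℕ j) ≡.refl (reflexive (≡.cong₂ _+_ (extend-toℕ x i) (extend-toℕ y j)))))) ⟩
      ∏ {n} (λ j → x j * ∏ (λ i → if does (i Finₚ.<? j) then x i + y j else 1#))
        ≈⟨ ∏-distrib-* x _ ⟩
      ∏ x * ∏ (λ j → ∏ (λ i → if does (i Finₚ.<? j) then x i + y j else 1#))
        -- The induction groups the factors by the larger index j, the theorem by the smaller index
        -- i.
        ≈⟨ *-congˡ (sym (∏-comm (λ i j → if does (i Finₚ.<? j) then x i + y j else 1#))) ⟩
      ∏ x * ∏-< (λ i j → x i + y j) ∎

    factor-Q : (a : ℕ → Carrier) → PrimedShifted.factor a x′ y′ y′ n ≈ ∏-≤ (λ i j → x i + y j)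
    factor-Q a = begin
      ∏[ 0 , n ⟩ (λ j → (x′ j + y′ j) * ∏[ 0 , j ⟩ (λ i → x′ i + y′ j))
        -- With z = y the diagonal factor is the missing case i = j of the inner product.
        ≈⟨ trans (interval-cong 0 n (λ j → trans (*-comm _ _) (sym (interval-last {0} {j} _ ℕ.z≤n)))) (∏-interval n (λ j → ∏[ 0 , suc j ⟩ (λ i → x′ i + y′ j))) ⟩
      ∏ {n} (λ j → ∏[ 0 , suc (toℕ j) ⟩ (λ i → x′ i + y′ (toℕ j)))
        ≈⟨ ∏-cong (λ j → trans (∏-initial (λ i → x′ i + y′ (toℕ j)) (Finₚ.toℕ<n j))
             (∏-cong λ i → if-cong (toℕ i <ᵇ suc (toℕ j)) (<ᵇ-suc (toℕ i) (toℕ j)) (reflexive (≡.cong₂ _+_ (extend-toℕ x i) (extend-toℕ y j))))) ⟩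
      ∏ {n} (λ j → ∏ (λ i → if does (i Finₚ.≤? j) then x i + y j else 1#))
        ≈⟨ sym (∏-comm (λ i j → if does (i Finₚ.≤? j) then x i + y j else 1#)) ⟩
      ∏-≤ (λ i j → x i + y j) ∎
      where
      <ᵇ-suc : ∀ i j → (i <ᵇ suc j) ≡ (i ≤ᵇ j)
      <ᵇ-suc zero    j = ≡.refl
      <ᵇ-suc (suc i) j = ≡.refl

  theorem : (n : ℕ) (μ : Vec ℕ n) → IsPartition μ → (x y : Fin n → Carrier) (a : ℕ → Carrier) →
    (schurP (μ ⊕ δ n) x y a ≈ (∏ (λ i → x i) * ∏-< {n} (λ i j → x i + y j)) * schur μ x a)
    × (schurQ (μ ⊕ δ n) x y a ≈ ∏-≤ {n} (λ i j → x i + y j) * schur μ x a)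
  theorem n μ partition x y a =
      trans (schurP≈ a x y (⊕δ-strict partition) (⊕δ-positive μ))
            (*-cong (factor-P x y a) (sym (schur≈Z a μ partition x)))
    , trans (schurQ≈ a x y (⊕δ-strict partition) (⊕δ-positive μ))
            (*-cong (factor-Q x y a) (sym (schur≈Z a μ partition x)))

theorem1 : ∀ {c ℓ} (R : CommutativeRing c ℓ) →
    let open CommutativeRing R
        open FactorialSchur R
    in
    (n : ℕ) → 1 ℕ.≤ n →
    (μ : Vec ℕ n) → IsPartition μ →
    (x y : Fin n → Carrier) (a : ℕ → Carrier) →
    (schurP (μ ⊕ δ n) x y a
      ≈ (∏ (λ i → x i) * ∏-< {n} (λ i j → x i + y j)) * schur μ x a)
    × (schurQ (μ ⊕ δ n) x y a
      ≈ ∏-≤ {n} (λ i j → x i + y j) * schur μ x a)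
theorem1 R n _ = Assembly.theorem R n
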